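{- Let $k\ge1$ and let $x\in\tilde S_{k+1}$ be an affine permutation. The four $k$-codes of $x$ equal the four affine codes of $x$; that is, for every $i\in\{0,1,\dots,k\}$: $$\mathrm{RD}(x)_i=\#\{j\in\mathbb Z: j<i+1,\ x(j)>x(i+1)\},$$ $$\mathrm{RI}(x)_i=\#\{j\in\mathbb Z: j>i,\ x(j)<x(i)\},$$ $$\mathrm{LD}(x)_i=\#\{j\in\mathbb Z: j<x^{ -1}(i),\ x(j)>i\},$$ $$\mathrm{LI}(x)_i=\#\{j\in\mathbb Z: j>x^{ -1}(i+1),\ x(j)<i+1\}.$$
   Context: Fix $k\ge1$, $I=\mathbb Z/(k+1)\mathbb Z=\{0,\dots,k\}$. $\tilde S_{k+1}$ is the group of bijections $x:\mathbb Z\to\mathbb Z$ with $x(i+k+1)=x(i)+k+1$ and $\sum_{i=1}^{k+1}x(i)=\binom{k+2}{2}$; $s_i$ ($i\in I$) exchanges $m(k+1)+i$ and $m(k+1)+i+1$ for all $m\in\mathbb Z$; products are compositions of functions, so right multiplication by $s_i$ acts on positions and left multiplication on values. The affine nil-Coxeter monoid is generated by $a_i$ ($i\in I$) and an absorbing zero, with relations $a_i^2=0$, $a_ia_j=a_ja_i$ for $j\notin\{i-1,i,i+1\}$, and (for $k\ge2$) $a_ia_{i+1}a_i=a_{i+1}a_ia_{i+1}$; its nonzero elements are identified with affine permutations by $a_{w_1}\cdots a_{w_l}\leftrightarrow s_{w_1}\cdots s_{w_l}$ for reduced words. For $A\subsetneq I$, $d_A$ (resp. $u_A$) is the product of the $a_i$,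 $i\in A$, each once, with $a_j$ to the left (resp. right) of $a_{j-1}$ whenever $j,j-1\in A$. For an affine permutation $x$ there are four canonical decompositions into nonempty proper subsets of $I$, each unique: right decreasing: $x=d_{A_n}\cdots d_{A_1}$ with $(|A_1|,\dots,|A_n|)$ lexicographically maximal; right increasing: $x=u_{B_m}\cdots u_{B_1}$ with $(|B_1|,\dots,|B_m|)$ lexicographically maximal; left decreasing: $x=d_{C_1}\cdots d_{C_r}$ with $(|C_1|,\dots,|C_r|)$ lexicographically maximal; left increasing: $x=u_{E_1}\cdots u_{E_t}$ with $(|E_1|,\dots,|E_t|)$ lexicographically maximal. The associated $k$-codes are $\mathrm{RD}(x)_i=\#\{j\ge 1: i-(j-1)\in A_j\}$, $\mathrm{RI}(x)_i=\#\{j\ge1: i+(j-1)\in B_j\}$, $\mathrm{LD}(x)_i=\#\{j\ge1: i+(j-1)\in C_j\}$, $\mathrm{LI}(x)_i=\#\{j\ge1: i-(j-1)\in E_j\}$, for $i\in I$. -}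

module Defs where

open import Data.Bool.Base using (if_then_else_)
open import Data.Fin.Base using (Fin; toℕ; fromℕ<)
open import Data.Fin.Properties using (_≟_)
open import Data.Fin.Subset using (Subset; ⊤; _∈_; _⊂_; Nonempty; ∣_∣)
open import Data.Fin.Subset.Properties using (_∈?_)
open import Data.Integer.Base using (ℤ; +_; _+_; _-_; _*_; 1ℤ; -1ℤ)
open import Data.Integer.DivMod using (n%ℕd<d)
open import Data.Integer.Properties using (+-0-commutativeMonoid)
open import Data.List.Base
  using (List; []; _∷_; _++_; map; concat; reverse; length; lookup; filter; allFin)
import Data.List.Membership.Propositional as List
open import Data.List.Relation.Binary.Lex.Strict using (Lex-≤)
open import Data.List.Relation.Binary.Pointwise using (Pointwise)
open import Data.List.Relation.Binary.Sublist.Propositional using (_⊆_)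
open import Data.List.Relation.Unary.All using (All)
open import Data.List.Relation.Unary.Unique.Propositional using (Unique)
open import Data.Nat.Base as ℕ using (ℕ; suc)
open import Data.Nat.Combinatorics using (_C_)
open import Data.Product using (Σ-syntax; ∃; ∃!; _×_; proj₁)
open import Function.Base using (_∘_; id)
open import Function.Bundles using (_↔_; _⇔_; Inverse)
open import Relation.Binary.PropositionalEquality using (_≡_; _≢_)
open import Relation.Nullary.Decidable.Core using (does)

open import Algebra.Properties.CommutativeMonoid.Sum +-0-commutativeMonoid using (sum)

private variable
  k : ℕ

-- Q holds of the unique element satisfying P (definite description).

The : {A : Set} → (A → Set) → (A → Set) → Set
The P Q = Σ[ u ∈ ∃! _≡_ P ] Q (proj₁ u)

-- I k is ℤ/(k+1)ℤ, with representatives 0, …, k.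

I : ℕ → Set
I k = Fin (suc k)

ι : I k → ℤ
ι i = + toℕ i

residue : ℤ → I k
residue {k} z = fromℕ< (n%ℕd<d z (suc k))

infixl 6 _⊕_

_⊕_ : I k → ℤ → I k
i ⊕ n = residue (ι i + n)

record AffinePermutation (k : ℕ) : Set where
  field
    perm       : ℤ ↔ ℤ
  open Inverse perm public using (to; from)
  field
    periodic   : ∀ z → to (z + + suc k) ≡ to z + + suc k
    normalised : sum {suc k} (λ j → to (+ suc (toℕ j))) ≡ + ((2 ℕ.+ k) C 2)

open AffinePermutation public using (to; from)

-- s i exchanges z and z + 1 for every z ≡ i mod k+1 (only meaningful for k ≥ 1).

s : I k → ℤ → ℤ
s i z =
  if does (residue z ≟ i) then z + 1ℤ
  else if does (residue (z - 1ℤ) ≟ i) then z - 1ℤ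
  else z

Word : ℕ → Set
Word k = List (I k)

-- The permutation s_{w₁} ∘ ⋯ ∘ s_{wₗ}: the last letter acts first.

act : Word k → ℤ → ℤ
act []      = id
act (i ∷ w) = s i ∘ act w

Reduced : Word k → Set
Reduced {k} w = (v : Word k) → (∀ z → act v z ≡ act w z) → length w ℕ.≤ length v

-- The affine nil-Coxeter monoid is List (Generator k) under _++_, taken up to _≈_.

data Generator (k : ℕ) : Set where
  a : I k → Generator k
  𝟎 : Generator k

infix 4 _≈_

data _≈_ {k : ℕ} : List (Generator k) → List (Generator k) → Set where
  ≈-refl   : ∀ {p} → p ≈ p
  ≈-sym    : ∀ {p q} → p ≈ q → q ≈ p
  ≈-trans  : ∀ {p q r} → p ≈ q → q ≈ r → p ≈ r
  ++-cong  : ∀ {p p′ q q′} → p ≈ p′ → q ≈ q′ → p ++ q ≈ p′ ++ q′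
  zeroˡ    : ∀ g → 𝟎 ∷ g ∷ [] ≈ 𝟎 ∷ []
  zeroʳ    : ∀ g → g ∷ 𝟎 ∷ [] ≈ 𝟎 ∷ []
  square   : ∀ i → a i ∷ a i ∷ [] ≈ 𝟎 ∷ []
  commute  : ∀ i j → j ≢ i ⊕ -1ℤ → j ≢ i → j ≢ i ⊕ 1ℤ →
             a i ∷ a j ∷ [] ≈ a j ∷ a i ∷ []
  braid    : 2 ℕ.≤ k → ∀ i →
             a i ∷ a (i ⊕ 1ℤ) ∷ a i ∷ [] ≈ a (i ⊕ 1ℤ) ∷ a i ∷ a (i ⊕ 1ℤ) ∷ []

-- p is the nonzero monoid element identified with the affine permutation x.

_Represents_ : List (Generator k) → AffinePermutation k → Set
p Represents x =
  ∃ λ v → Reduced v × (∀ z → act v z ≡ to x z) × p ≈ map a v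

record EachOnce (A : Subset (suc k)) (w : Word k) : Set where
  field
    unique  : Unique w
    letters : ∀ i → i List.∈ w ⇔ i ∈ A

-- w spells out d_A, resp. u_A.  The list inclusion j ∷ j′ ∷ [] ⊆ w is the
-- order-preserving one, so it says that j occurs to the left of j′.

Decreasing Increasing : Subset (suc k) → Word k → Set
Decreasing A w = EachOnce A w ×
  (∀ j → j ∈ A → j ⊕ -1ℤ ∈ A → j ∷ j ⊕ -1ℤ ∷ [] ⊆ w)
Increasing A w = EachOnce A w ×
  (∀ j → j ∈ A → j ⊕ -1ℤ ∈ A → j ⊕ -1ℤ ∷ j ∷ [] ⊆ w)

-- As lists the subsets A₁, A₂, … in order of their index; assemble says
-- whether the corresponding factors are multiplied as 1 ⋯ n or as n ⋯ 1.

record Decomposition (Spells : Subset (suc k) → Word k → Set)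
                     (assemble : List (Word k) → Word k)
                     (x : AffinePermutation k)
                     (As : List (Subset (suc k))) : Set where
  field
    proper  : All (λ A → Nonempty A × A ⊂ ⊤) As
    words   : List (Word k)
    spelled : Pointwise Spells As words
    product : map a (assemble words) Represents x

Canonical : (Subset (suc k) → Word k → Set) → (List (Word k) → Word k) →
            AffinePermutation k → List (Subset (suc k)) → Set
Canonical Spells assemble x As =
  Decomposition Spells assemble x As ×
  (∀ Bs → Decomposition Spells assemble x Bs →
     Lex-≤ _≡_ ℕ._<_ (map ∣_∣ Bs) (map ∣_∣ As))

RightDecreasing RightIncreasing LeftDecreasing LeftIncreasing :
  AffinePermutation k → List (Subset (suc k)) → Set
RightDecreasing = Canonical Decreasing (concat ∘ reverse)
RightIncreasing = Canonical Increasing (concat ∘ reverse)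
LeftDecreasing  = Canonical Decreasing concat
LeftIncreasing  = Canonical Increasing concat

-- The number of indices j with i + ε j ∈ A_{j+1}, j counted from 0.

shiftedCount : ℤ → List (Subset (suc k)) → I k → ℕ
shiftedCount ε As i =
  length (filter (λ j → i ⊕ ε * + toℕ j ∈? lookup As j) (allFin (length As)))

RD RI LD LI : List (Subset (suc k)) → I k → ℕ
RD = shiftedCount -1ℤ
RI = shiftedCount 1ℤ
LD = shiftedCount 1ℤ
LI = shiftedCount -1ℤ

{-# OPTIONS --safe #-}
module Submission where

-- The increasing right decomposition is treated directly.  As a map, u_B sends z to z + 1 if
-- z mod k+1 lies in B, and otherwise moves z down to the start of the run of B ending below z.
-- Hence if x = y u_B with lengths adding, every i ∈ B starts an inversion j > i, x(j) < x(i), so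
-- the set A of positions starting an inversion is the largest possible first factor.  For B = A
-- exactly one inversion is lost: the inversions of x at i ∈ A are those of y at i + 1 together
-- with the first j > i outside A, and for i ∉ A both sets are empty.  Iterating gives the code,
-- and the iteration ends because the maximal distance j - i of an inversion drops.
-- Inverting x reverses words and conjugating by z ↦ 1 - z negates letters; both exchange
-- increasing with decreasing products, which yields the other three decompositions.

open import Defs renaming (a to gen)
import Algebra.Properties.CommutativeMonoid.Sum as Sum
open import Data.Bool.Base using (if_then_else_; true; false)
open import Data.Empty using (⊥; ⊥-elim)
open import Data.Fin.Base using (Fin; zero; suc; toℕ)
open import Data.Fin.Permutation using (permutation)
import Data.Fin.Properties as Fin
open import Data.Fin.Subset using (Subset; _∈_; _∉_; _⊂_; Nonempty)
  renaming (⊤ to full; _⊆_ to _⊆ˢ_; ∣_∣ to card)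
open import Data.Fin.Subset.Properties using (_∈?_; ∈⊤; p⊂q⇒∣p∣<∣q∣; ⊆-antisym)
open import Data.Integer.Base
  using (ℤ; +_; -[1+_]; _+_; _-_; -_; _*_; _<_; _>_; 0ℤ; 1ℤ; -1ℤ; ∣_∣; +≤+; -≤+)
open import Data.Integer.DivMod using (n%ℕd<d; a≡a%ℕn+[a/ℕn]*n; _/ℕ_)
import Data.Integer.Properties as ℤ
open import Data.Integer.Tactic.RingSolver using (solve-∀)
open import Data.List.Base
  using (List; []; _∷_; _++_; map; reverse; concat; length; filter; lookup; applyUpTo; [_])
  renaming (tabulate to tabulateˡ)
import Data.List.Membership.DecPropositional as DecMembership
open import Data.List.Membership.Propositional using () renaming (_∈_ to _∈ˡ_; _∉_ to _∉ˡ_)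
open import Data.List.Membership.Propositional.Properties
  using (∈-filter⁺; ∈-filter⁻; ∈-applyUpTo⁺; ∈-map⁺; ∈-map⁻)
import Data.List.Properties as List
open import Data.List.Relation.Binary.Lex.Core using (base; halt; this; next)
open import Data.List.Relation.Binary.Lex.Strict using (Lex-≤)
open import Data.List.Relation.Binary.Permutation.Propositional using (↭-sym; ↭⇒↭ₛ)
open import Data.List.Relation.Binary.Permutation.Propositional.Properties using (↭-reverse)
import Data.List.Relation.Binary.Permutation.Setoid.Properties as Permutation
open import Data.List.Relation.Binary.Pointwise using (Pointwise; []; _∷_)
open import Data.List.Relation.Binary.Sublist.Propositional using (_⊆_; []; _∷_; _∷ʳ_; to∈; from∈)
import Data.List.Relation.Binary.Sublist.Propositional.Properties as Sublist
open import Data.List.Relation.Unary.All as All using (All; []; _∷_)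
import Data.List.Relation.Unary.All.Properties as All
open import Data.List.Relation.Unary.AllPairs as AllPairs using (AllPairs; []; _∷_)
import Data.List.Relation.Unary.AllPairs.Properties as AllPairs
open import Data.List.Relation.Unary.Any using (here; there)
import Data.List.Relation.Unary.Any.Properties as Any
open import Data.List.Relation.Unary.Unique.Propositional using (Unique)
import Data.List.Relation.Unary.Unique.Propositional.Properties as Unique
open import Data.List.Reverse using (Reverse; reverseView; []; _∶_∶ʳ_)
open import Data.Nat.Base as ℕ using (ℕ; suc)
open import Data.Nat.Combinatorics using (_C_; nC1≡n; nCk+nC[k+1]≡[n+1]C[k+1])
import Data.Nat.Properties as ℕ
open import Data.Product using (∃; _×_; _,_; proj₁; proj₂)
open import Data.Sum using (_⊎_; inj₁; inj₂; [_,_]′)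
open import Data.Unit.Base using (⊤; tt)
open import Data.Vec.Base as Vec using ([]; _∷_)
import Data.Vec.Properties as Vec
open import Function.Base using (_∘_; id; const; case_of_)
open import Function.Bundles using (_⇔_; mk⇔; Equivalence; _↔_; mk↔ₛ′; Inverse)
open import Function.Construct.Composition using (_↔-∘_)
open import Relation.Binary.Definitions using (tri<; tri≈; tri>)
open import Relation.Binary.PropositionalEquality hiding ([_])
open import Relation.Nullary using (¬_; Dec; yes; no; contradiction; does)
open import Relation.Nullary.Decidable using (_×-dec_; map′; dec-true; does-⇔; ¬?)

open import Algebra.Properties.AbelianGroup ℤ.+-0-abelianGroup using (∙-cancelˡ; ∙-cancelʳ)
open Sum ℤ.+-0-commutativeMonoid using (sum; sum-cong-≗; sum-init-last; ∑-distrib-+)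
private module ℕ-Sum = Sum ℕ.+-0-commutativeMonoid

open Equivalence using () renaming (to to ⇒; from to ⇐)

-- A decomposition is tied to x only through the congruence `_≈_`, so it must first be known that a
-- word congruent to a reduced word is itself reduced and acts in the same way. This is read off an
-- invariant of `_≈_`: `Valid x p` asks that each letter of p in turn meets an ascent, starting from
-- an arbitrary map x. Reducedness is the case x = id; the general x is what lets the condition
-- split across a product. The ascents also exhibit the inversions that a factor forces, so the
-- number of inversions never has to be compared with the length.
--
-- Factors are stripped off maps that are periodic and injective. The greedy process then stops at a
-- translation, and the condition on the sum shows that this translation is the identity.
--
-- The lexicographic order sees only cardinalities, so by itself it gives no uniqueness. That comes
-- from containment: a first factor always lies inside A, and a subset of A with as many elements is
-- A itself.

module KCodes (k : ℕ) (1≤k : 1 ℕ.≤ k) where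
  open import Data.Integer.Base using (_≤_)
  open DecMembership (Fin._≟_ {suc k}) using () renaming (_∈?_ to _∈ˡ?_)


  -- Integers, residues and the maps s i

  ≤-witness : ∀ {a b e} → 0ℤ ≤ e → b ≡ a + e → a ≤ b
  ≤-witness {a} {b} {e} 0≤e b≡a+e = subst₂ _≤_ (ℤ.+-identityʳ a) (sym b≡a+e) (ℤ.+-monoʳ-≤ a 0≤e)

  <⇒+1≤ : ∀ {a b} → a < b → a + 1ℤ ≤ b
  <⇒+1≤ {a} {b} a<b = subst (_≤ b) (ℤ.+-comm 1ℤ a) (ℤ.i<j⇒suc[i]≤j a<b)

  +1≤⇒< : ∀ {a b} → a + 1ℤ ≤ b → a < b
  +1≤⇒< {a} {b} a+1≤b = ℤ.suc[i]≤j⇒i<j (subst (_≤ b) (ℤ.+-comm a 1ℤ) a+1≤b)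

  <⇒0≤ : ∀ {a b} → a < b → 0ℤ ≤ b - (a + 1ℤ)
  <⇒0≤ a<b = ℤ.i≤j⇒0≤j-i (<⇒+1≤ a<b)

  ≤⇒0≤ : ∀ {a b} → a ≤ b → 0ℤ ≤ b - a
  ≤⇒0≤ = ℤ.i≤j⇒0≤j-i

  <+1⇒≤ : ∀ {a b} → a < b + 1ℤ → a ≤ b
  <+1⇒≤ {a} {b} a<b+1 = ≤-witness (<⇒0≤ a<b+1) (lem a b)
    where lem : ∀ a b → b ≡ a + (b + 1ℤ - (a + 1ℤ))
          lem = solve-∀

  ≤⇒<+1 : ∀ {a b} → a ≤ b → a < b + 1ℤ
  ≤⇒<+1 a≤b = +1≤⇒< (ℤ.+-monoˡ-≤ 1ℤ a≤b)

  <+1 : ∀ a → a < a + 1ℤ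
  <+1 a = ≤⇒<+1 ℤ.≤-refl

  -1+1 : ∀ a → a - 1ℤ + 1ℤ ≡ a
  -1+1 = solve-∀

  -1< : ∀ a → a - 1ℤ < a
  -1< a = +1≤⇒< (ℤ.≤-reflexive (-1+1 a))

  ≤-split : ∀ {a b} → a ≤ b → a ≡ b ⊎ a + 1ℤ ≤ b
  ≤-split {a} {b} a≤b with a ℤ.≟ b
  ... | yes p = inj₁ p
  ... | no p = inj₂ (<⇒+1≤ (ℤ.≤∧≢⇒< a≤b p))

  +1-1 : ∀ a → a + 1ℤ - 1ℤ ≡ a
  +1-1 = solve-∀

  +-1+ : ∀ z n → z + (1ℤ + n) ≡ z + 1ℤ + n
  +-1+ = solve-∀

  +-swap : ∀ a b c → a + b + c ≡ a + c + b
  +-swap = solve-∀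

  ≤⇒+ : ∀ {a b} → a ≤ b → ∃ λ m → b ≡ a + + m
  ≤⇒+ {a} {b} a≤b = ∣ b - a ∣ , trans (lem a b) (cong (λ x → a + x) (sym (ℤ.0≤i⇒+∣i∣≡i (≤⇒0≤ a≤b))))
    where lem : ∀ a b → b ≡ a + (b - a)
          lem = solve-∀

  N : ℤ
  N = + suc k

  remainder-unique : ∀ {r r′} q → r ℕ.< suc k → r′ ℕ.< suc k → + r ≡ + r′ + q * N → r ≡ r′
  remainder-unique {r} {r′} (+ 0) _ _ eq = ℤ.+-injective (trans eq (ℤ.+-identityʳ (+ r′)))
  remainder-unique {r} {r′} (+ suc q) r< _ eq =
    contradiction r< (ℕ.≤⇒≯ (ℕ.≤-trans (ℕ.≤-trans (ℕ.m≤m+n (suc k) (q ℕ.* suc k)) (ℕ.m≤n+m _ r′))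
        (ℕ.≤-reflexive (sym (ℤ.+-injective eq)))))
  remainder-unique {r} {r′} -[1+ q ] r< r′< eq =
    sym (remainder-unique (+ suc q) r′< r<
        (trans (lem (+ r′) (-[1+ q ] * N)) (cong₂ _+_ (sym eq) (ℤ.neg-distribˡ-* -[1+ q ] N))))
    where lem : ∀ a b → a ≡ (a + b) + - b
          lem = solve-∀

  residue-split : ∀ z → z ≡ ι (residue {k} z) + (z /ℕ suc k) * N
  residue-split z = trans (a≡a%ℕn+[a/ℕn]*n z (suc k))
      (cong (λ r → + r + (z /ℕ suc k) * N) (sym (Fin.toℕ-fromℕ< (n%ℕd<d z (suc k)))))

  residue-unique : ∀ {z} {i : I k} q → z ≡ ι i + q * N → residue z ≡ i
  residue-unique {z} {i} q eq = Fin.toℕ-injective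
    (remainder-unique (q - z /ℕ suc k) (Fin.toℕ<n (residue z)) (Fin.toℕ<n i)
      (lem (ι (residue {k} z)) (ι i) (z /ℕ suc k) q N (trans (sym (residue-split z)) eq)))
    where
    lem₁ : ∀ a p n → a ≡ (a + p * n) - p * n
    lem₁ = solve-∀
    lem₂ : ∀ b p q n → (b + q * n) - p * n ≡ b + (q - p) * n
    lem₂ = solve-∀
    lem : ∀ a b p q n → a + p * n ≡ b + q * n → a ≡ b + (q - p) * n
    lem a b p q n e = trans (lem₁ a p n) (trans (cong (_- p * n) e) (lem₂ b p q n))

  residue-ι : ∀ i → residue (ι i) ≡ i
  residue-ι i = residue-unique 0ℤ (sym (ℤ.+-identityʳ (ι i)))

  residue-shift : ∀ z q → residue (z + q * N) ≡ residue {k} z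
  residue-shift z q = residue-unique (z /ℕ suc k + q)
      (trans (cong (_+ q * N) (residue-split z)) (lem (ι (residue {k} z)) (z /ℕ suc k) q N))
    where lem : ∀ a p q n → a + p * n + q * n ≡ a + (p + q) * n
          lem = solve-∀

  residue-≡⇒ : ∀ y z → residue {k} y ≡ residue z → ∃ λ q → y ≡ z + q * N
  residue-≡⇒ y z eq = y /ℕ suc k - z /ℕ suc k ,
    trans (residue-split y) (trans (lem (ι (residue {k} y)) (y /ℕ suc k) (z /ℕ suc k) N)
      (cong (_+ (y /ℕ suc k - z /ℕ suc k) * N)
          (trans (cong (λ i → ι i + (z /ℕ suc k) * N) eq) (sym (residue-split z)))))
    where lem : ∀ a p q n → a + p * n ≡ a + q * n + (p - q) * n
          lem = solve-∀

  residue-+ : ∀ y z m → residue {k} y ≡ residue z → residue {k} (y + m) ≡ residue (z + m)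
  residue-+ y z m eq with q , refl ← residue-≡⇒ y z eq =
    trans (cong residue (+-swap z (q * N) m)) (residue-shift (z + m) q)

  residue-⊕ : ∀ z m → residue {k} z ⊕ m ≡ residue (z + m)
  residue-⊕ z m = residue-+ (ι (residue {k} z)) z m (residue-ι (residue z))

  ⊕-residue : ∀ {i : I k} z m → residue z ≡ i → i ⊕ m ≡ residue (z + m)
  ⊕-residue z m refl = residue-⊕ z m

  ⊕-⊕ : ∀ (i : I k) m n → i ⊕ m ⊕ n ≡ i ⊕ (m + n)
  ⊕-⊕ i m n = trans (residue-⊕ (ι i + m) n) (cong residue (ℤ.+-assoc (ι i) m n))

  ⊕-0 : ∀ (i : I k) → i ⊕ 0ℤ ≡ i
  ⊕-0 i = trans (cong residue (ℤ.+-identityʳ (ι i))) (residue-ι i)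

  residue-+-≢ : ∀ z d → 0 ℕ.< d → d ℕ.< suc k → residue {k} (z + + d) ≢ residue z
  residue-+-≢ z d 0<d d<n eq with q , e ← residue-≡⇒ (z + + d) z eq =
    ℕ.<⇒≢ 0<d (sym (remainder-unique q d<n (ℕ.s≤s ℕ.z≤n)
        (trans (∙-cancelˡ z (+ d) (q * N) e) (sym (ℤ.+-identityˡ _)))))

  -- `1≤k` enters here: with a single residue class every position would be congruent to its
  -- neighbour, and `s i` would not be an exchange.
  residue-+1-≢ : ∀ z → residue {k} (z + 1ℤ) ≢ residue z
  residue-+1-≢ z = residue-+-≢ z 1 (ℕ.s≤s ℕ.z≤n) (ℕ.s≤s 1≤k)

  residue--1-≢ : ∀ z → residue {k} (z - 1ℤ) ≢ residue z
  residue--1-≢ z eq = residue-+1-≢ (z - 1ℤ) (trans (cong residue (-1+1 z)) (sym eq))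

  residue-1≡⇒ : ∀ y {i : I k} → residue (y - 1ℤ) ≡ i → residue y ≡ i ⊕ 1ℤ
  residue-1≡⇒ y refl = trans (cong residue (sym (-1+1 y))) (sym (residue-⊕ (y - 1ℤ) 1ℤ))

  residue-+1-cancel : ∀ y z → residue {k} (y + 1ℤ) ≡ residue (z + 1ℤ) → residue {k} y ≡ residue z
  residue-+1-cancel y z eq = subst₂ (λ a b → residue {k} a ≡ residue b) (+1-1 y) (+1-1 z)
      (residue-+ (y + 1ℤ) (z + 1ℤ) -1ℤ eq)

  s-up : ∀ {i : I k} z → residue z ≡ i → s i z ≡ z + 1ℤ
  s-up {i} z eq with residue z Fin.≟ i
  ... | yes _ = refl
  ... | no ¬p = contradiction eq ¬p

  s-down : ∀ {i : I k} z → residue z ≡ i → s i (z + 1ℤ) ≡ z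
  s-down {i} z eq with residue (z + 1ℤ) Fin.≟ i
  ... | yes p = contradiction (trans p (sym eq)) (residue-+1-≢ z)
  ... | no _ with residue ((z + 1ℤ) - 1ℤ) Fin.≟ i
  ...   | yes _ = +1-1 z
  ...   | no ¬p = contradiction (trans (cong residue (+1-1 z)) eq) ¬p

  s-fix : ∀ {i : I k} z → residue z ≢ i → residue (z - 1ℤ) ≢ i → s i z ≡ z
  s-fix {i} z p q with residue z Fin.≟ i
  ... | yes e = contradiction e p
  ... | no _ with residue (z - 1ℤ) Fin.≟ i
  ...   | yes e = contradiction e q
  ...   | no _ = refl

  -- Both moving cases are indexed by the lower of the two exchanged positions, the one congruent to
  -- `i`, so that the residue hypothesis has the same form in each.
  data Moves (i : I k) : ℤ → Set where
    up   : ∀ {z} → residue z ≡ i → s i z ≡ z + 1ℤ → Moves i z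
    down : ∀ {z} → residue z ≡ i → s i (z + 1ℤ) ≡ z → Moves i (z + 1ℤ)
    fix  : ∀ {z} → residue z ≢ i → residue (z - 1ℤ) ≢ i → s i z ≡ z → Moves i z

  moves : ∀ i z → Moves i z
  moves i z with residue z Fin.≟ i | residue (z - 1ℤ) Fin.≟ i
  ... | yes p | _ = up p (s-up z p)
  ... | no p | yes q = subst (Moves i) (-1+1 z) (down q (s-down (z - 1ℤ) q))
  ... | no p | no q = fix p q (s-fix z p q)

  s-involutive : ∀ i z → s {k} i (s i z) ≡ z
  s-involutive i z with moves i z
  ... | up p e = trans (cong (s i) e) (s-down z p)
  ... | down {y} p e = trans (cong (s i) e) (s-up y p)
  ... | fix p q e = trans (cong (s i) e) e

  Periodic : (ℤ → ℤ) → Set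
  Periodic f = ∀ z q → f (z + q * N) ≡ f z + q * N

  Injective : (ℤ → ℤ) → Set
  Injective f = ∀ {y z} → f y ≡ f z → y ≡ z

  s-periodic : ∀ i → Periodic (s i)
  s-periodic i z q with moves i z
  ... | up p e = trans (s-up (z + q * N) (trans (residue-shift z q) p))
      (trans (+-swap z (q * N) 1ℤ) (cong (_+ q * N) (sym e)))
  ... | down {y} p e = trans (cong (s i) (+-swap y 1ℤ (q * N)))
      (trans (s-down (y + q * N) (trans (residue-shift y q) p)) (cong (_+ q * N) (sym e)))
  ... | fix {y} p r e = trans (s-fix (y + q * N) (p ∘ trans (sym (residue-shift y q)))
      (r ∘ trans (trans (sym (residue-shift (y - 1ℤ) q)) (cong residue (+-swap y -1ℤ (q * N))))))
      (cong (_+ q * N) (sym e))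

  periodic : ∀ {f} → (∀ z → f (z + N) ≡ f z + N) → Periodic f
  periodic {f} p = λ where
      z (+ n)    → pos z n
      z -[1+ n ] → trans (lem₀ (f _) (+ suc n) N)
        (cong (_+ (- (+ suc n)) * N) (trans (sym (pos _ (suc n))) (cong f (lem₀ʳ z (+ suc n) N))))
    where
    lem₀ : ∀ a q n → a ≡ a + q * n + - q * n
    lem₀ = solve-∀
    lem₀ʳ : ∀ a q n → a + - q * n + q * n ≡ a
    lem₀ʳ = solve-∀
    lem : ∀ a q n → a + (1ℤ + q) * n ≡ a + q * n + n
    lem = solve-∀
    pos : ∀ z n → f (z + + n * N) ≡ f z + + n * N
    pos z 0 = trans (cong f (ℤ.+-identityʳ z)) (sym (ℤ.+-identityʳ (f z)))
    pos z (suc n) = trans (cong f (lem z (+ n) N))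
        (trans (p _) (trans (cong (_+ N) (pos z n)) (sym (lem (f z) (+ n) N))))

  displacement-residue : ∀ {f} → Periodic f → ∀ y z → residue {k} y ≡ residue z → f y - y ≡ f z - z
  displacement-residue {f} p y z eq with q , refl ← residue-≡⇒ y z eq = trans
      (cong (_- (z + q * N)) (p z q)) (lem (f z) z (q * N))
    where lem : ∀ a b c → (a + c) - (b + c) ≡ a - b
          lem = solve-∀

  -- Length-additive products and the nil-Coxeter relations

  act-++ : ∀ (v w : Word k) z → act (v ++ w) z ≡ act v (act w z)
  act-++ []      w z = refl
  act-++ (i ∷ v) w z = cong (s i) (act-++ v w z)

  act-reverseˡ : ∀ (w : Word k) z → act (reverse w) (act w z) ≡ z
  act-reverseˡ []      z = refl
  act-reverseˡ (i ∷ w) z = begin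
    act (reverse (i ∷ w)) (s i (act w z))      ≡⟨ cong (λ v → act v (s i (act w z)))
        (List.unfold-reverse i w) ⟩
    act (reverse w ++ [ i ]) (s i (act w z))   ≡⟨ act-++ (reverse w) [ i ] _ ⟩
    act (reverse w) (s i (s i (act w z)))      ≡⟨ cong (act (reverse w)) (s-involutive i (act w z)) ⟩
    act (reverse w) (act w z)                  ≡⟨ act-reverseˡ w z ⟩
    z                                          ∎
    where open ≡-Reasoning

  act-reverseʳ : ∀ (w : Word k) z → act w (act (reverse w) z) ≡ z
  act-reverseʳ w z = trans (cong (λ v → act v (act (reverse w) z)) (sym (List.reverse-involutive w)))
      (act-reverseˡ (reverse w) z)

  act-injective : ∀ (w : Word k) → Injective (act w)
  act-injective w {y} {z} eq = trans (sym (act-reverseˡ w y))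
      (trans (cong (act (reverse w)) eq) (act-reverseˡ w z))

  act-periodic : ∀ (w : Word k) → Periodic (act w)
  act-periodic []      z q = refl
  act-periodic (i ∷ w) z q = trans (cong (s i) (act-periodic w z q)) (s-periodic i (act w z) q)

  s-≤ : ∀ i z → s {k} i z ≤ z + 1ℤ
  s-≤ i z with moves i z
  ... | up p e = ℤ.≤-reflexive e
  ... | down {y} p e = subst (_≤ y + 1ℤ + 1ℤ) (sym e) (ℤ.<⇒≤ (ℤ.<-trans (<+1 y) (<+1 (y + 1ℤ))))
  ... | fix p q e = subst (_≤ z + 1ℤ) (sym e) (ℤ.<⇒≤ (<+1 z))

  s-≥ : ∀ i z → z ≤ s {k} i z + 1ℤ
  s-≥ i z = subst (_≤ s i z + 1ℤ) (s-involutive i z) (s-≤ i (s i z))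

  -- `s i` moves a point by at most 1. Two points whose order it reverses are therefore adjacent,
  -- and the lower one has to move up.
  s-flip : ∀ {i : I k} {y z} → y < z → s i z < s i y → residue y ≡ i × z ≡ y + 1ℤ
  s-flip {i} {y} {z} y<z sz<sy = lem , z≡
    where
    z≡ : z ≡ y + 1ℤ
    z≡ = ℤ.≤-antisym (ℤ.≤-trans (ℤ.≤-trans (s-≥ i z) (<⇒+1≤ sz<sy)) (s-≤ i y)) (<⇒+1≤ y<z)
    sy≰ : ¬ s i y ≤ y
    sy≰ sy≤y = ℤ.<⇒≱ y<z (ℤ.≤-trans (s-≥ i z) (ℤ.≤-trans (<⇒+1≤ sz<sy) sy≤y))
    lem : residue y ≡ i
    lem with moves i y
    ... | up p _ = p
    ... | down {y′} p e = contradiction (ℤ.≤-trans (ℤ.≤-reflexive e) (ℤ.<⇒≤ (<+1 y′))) sy≰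
    ... | fix p q e = contradiction (ℤ.≤-reflexive e) sy≰

  -- Exchange property: the letter at which the images of z and z + 1 cross is dropped.
  deletion : ∀ (w : Word k) (i : I k) z → residue z ≡ i → act w (z + 1ℤ) < act w z →
    ∃ λ (v : Word k) → suc (length v) ≡ length w × (∀ y → act v y ≡ act w (s i y))
  deletion []      i z p lt = contradiction lt (ℤ.<-asym (<+1 z))
  deletion (j ∷ w) i z p lt with act w (z + 1ℤ) ℤ.<? act w z
  ... | yes lt′ with v , l , e ← deletion w i z p lt′ = j ∷ v , cong suc l , λ y → cong (s j) (e y)
  ... | no ≮ = w , refl , same
    where
    flip = s-flip (ℤ.≤∧≢⇒< (ℤ.≮⇒≥ ≮) λ e → ℤ.<⇒≢ (<+1 z) (act-injective w e)) lt
    at : ∀ y → residue y ≡ residue {k} z → residue (act w y) ≡ j × act w (y + 1ℤ) ≡ act w y + 1ℤ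
    at y e with q , refl ← residue-≡⇒ y z e =
      trans (trans (cong residue (act-periodic w z q)) (residue-shift (act w z) q)) (proj₁ flip) ,
      (begin
        act w (z + q * N + 1ℤ)     ≡⟨ cong (act w) (+-swap z (q * N) 1ℤ) ⟩
        act w (z + 1ℤ + q * N)     ≡⟨ act-periodic w (z + 1ℤ) q ⟩
        act w (z + 1ℤ) + q * N     ≡⟨ cong (_+ q * N) (proj₂ flip) ⟩
        act w z + 1ℤ + q * N       ≡⟨ +-swap (act w z) 1ℤ (q * N) ⟩
        act w z + q * N + 1ℤ       ≡⟨ cong (_+ 1ℤ) (sym (act-periodic w z q)) ⟩
        act w (z + q * N) + 1ℤ     ∎)
      where open ≡-Reasoning
    from-at : ∀ y → residue (act w y) ≡ j → residue y ≡ residue {k} z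
    from-at y e with q , e′ ← residue-≡⇒ (act w y) (act w z) (trans e (sym (proj₁ flip))) =
      trans (cong residue (act-injective w (trans e′ (sym (act-periodic w z q))))) (residue-shift z q)
    -- By `at` and `from-at`, `act w` matches the pairs exchanged by `s i` with those exchanged by
    -- `s j`. So `s j` after `act w` equals `act w` after `s i`, and deleting `j` amounts to `s i`
    -- on the right.
    same : ∀ y → act w y ≡ s j (act w (s i y))
    same y with moves i y
    ... | up q e with r , e′ ← at y (trans q (sym p)) =
      sym (trans (cong (s j ∘ act w) e) (trans (cong (s j) e′) (s-down (act w y) r)))
    ... | down {y′} q e with r , e′ ← at y′ (trans q (sym p)) =
      sym (trans (cong (s j ∘ act w) e) (trans (s-up (act w y′) r) (sym e′)))
    ... | fix q r e = sym (trans (cong (s j ∘ act w) e)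
      (s-fix (act w y) (λ e′ → q (trans (from-at y e′) p))
        (λ e′ → let x = act (reverse w) (act w y - 1ℤ)
                    wx : act w x ≡ act w y - 1ℤ
                    wx = act-reverseʳ w _
                    rx = from-at x (trans (cong residue wx) e′)
                    x+1 : x + 1ℤ ≡ y
                    x+1 = act-injective w (trans (proj₂ (at x rx))
                        (trans (cong (_+ 1ℤ) wx) (-1+1 (act w y))))
                in r (trans (cong residue (trans (cong (_- 1ℤ) (sym x+1)) (+1-1 x))) (trans rx p)))))

  -- Valid words and their invariance under the nil-Coxeter relations

  Ascent : (ℤ → ℤ) → I k → Set
  Ascent x i = ∀ z → residue z ≡ i → x z < x (z + 1ℤ)

  -- Starting from x, right multiplication by the successive letters only lengthens.
  Valid : (ℤ → ℤ) → List (Generator k) → Set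
  Valid x []          = ⊤
  Valid x (gen i ∷ p) = Ascent x i × Valid (x ∘ s i) p
  Valid x (𝟎 ∷ p)     = ⊥

  actᵍ : List (Generator k) → ℤ → ℤ
  actᵍ []          = id
  actᵍ (gen i ∷ p) = s i ∘ actᵍ p
  actᵍ (𝟎 ∷ p)     = actᵍ p

  Valid-cong : ∀ {x y} p → (∀ z → x z ≡ y z) → Valid x p → Valid y p
  Valid-cong []          e v = tt
  Valid-cong (gen i ∷ p) e (asc , v) = (λ z r → subst₂ _<_ (e z) (e (z + 1ℤ)) (asc z r)) , Valid-cong p
      (λ z → e (s i z)) v

  Valid-++⁺ : ∀ {x} p q → Valid x p → Valid (x ∘ actᵍ p) q → Valid x (p ++ q)
  Valid-++⁺ []          q v v′ = v′
  Valid-++⁺ (gen i ∷ p) q (asc , v) v′ = asc , Valid-++⁺ p q v v′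

  Valid-++⁻ : ∀ {x} p q → Valid x (p ++ q) → Valid x p × Valid (x ∘ actᵍ p) q
  Valid-++⁻ []          q v = tt , v
  Valid-++⁻ (gen i ∷ p) q (asc , v) with v₁ , v₂ ← Valid-++⁻ p q v = (asc , v₁) , v₂

  actᵍ-++ : ∀ p q z → actᵍ (p ++ q) z ≡ actᵍ p (actᵍ q z)
  actᵍ-++ []          q z = refl
  actᵍ-++ (gen i ∷ p) q z = cong (s i) (actᵍ-++ p q z)
  actᵍ-++ (𝟎 ∷ p)     q z = actᵍ-++ p q z

  actᵍ-map : ∀ (w : Word k) z → actᵍ (map gen w) z ≡ act w z
  actᵍ-map []      z = refl
  actᵍ-map (i ∷ w) z = cong (s i) (actᵍ-map w z)

  -- 𝟎 acts as the identity, which is harmless: no word containing it is Valid.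
  Same : List (Generator k) → List (Generator k) → Set
  Same p q = ∀ x → (Valid x p → Valid x q) × (Valid x q → Valid x p) ×
      (Valid x p → ∀ z → actᵍ p z ≡ actᵍ q z)

  Far : I k → I k → Set
  Far i j = ∀ z → residue z ≡ j → s i z ≡ z × s i (z + 1ℤ) ≡ z + 1ℤ

  far : ∀ {i j : I k} → j ≢ i ⊕ -1ℤ → j ≢ i → j ≢ i ⊕ 1ℤ → Far i j × Far j i
  far {i} {j} p q r =
    (λ { z refl → s-fix z q (r ∘ residue-1≡⇒ z) ,
                  s-fix (z + 1ℤ) (λ e → p (trans (cong residue (sym (+1-1 z)))
                      (sym (⊕-residue (z + 1ℤ) -1ℤ e))))
                      (λ e → q (trans (cong residue (sym (+1-1 z))) e)) }) ,
    (λ { z refl → s-fix z (q ∘ sym) (λ e → p (trans (sym e) (sym (residue-⊕ z -1ℤ)))) ,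
                  s-fix (z + 1ℤ) (λ e → r (trans (sym e) (sym (residue-⊕ z 1ℤ))))
                      (λ e → q (sym (trans (cong residue (sym (+1-1 z))) e))) })

  far-ascent : ∀ {i j x} → Far i j → Ascent x j → Ascent (x ∘ s i) j
  far-ascent {x = x} f asc z r with e , e′ ← f z r = subst₂ _<_ (cong x (sym e)) (cong x (sym e′)) (asc z r)

  far-ascent⁻ : ∀ {i j x} → Far i j → Ascent (x ∘ s i) j → Ascent x j
  far-ascent⁻ {x = x} f asc z r with e , e′ ← f z r = subst₂ _<_ (cong x e) (cong x e′) (asc z r)

  far-commute : ∀ {i j} → Far i j → Far j i → ∀ z → s i (s j z) ≡ s j (s i z)
  far-commute {i} {j} f g z with moves j z
  ... | up p e with e₁ , e₂ ← f z p = trans (cong (s i) e) (trans e₂ (trans (sym e) (cong (s j) (sym e₁))))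
  ... | down {y} p e with e₁ , e₂ ← f y p = trans (cong (s i) e)
      (trans e₁ (trans (sym e) (cong (s j) (sym e₂))))
  ... | fix _ _ e with moves i z
  ...   | up p e′ = trans (cong (s i) e) (trans e′ (trans (sym (proj₂ (g z p))) (cong (s j) (sym e′))))
  ...   | down {y} p e′ = trans (cong (s i) e)
      (trans e′ (trans (sym (proj₁ (g y p))) (cong (s j) (sym e′))))
  ...   | fix _ _ e′ = trans (cong (s i) e) (trans e′ (trans (sym e) (cong (s j) (sym e′))))

  commute-same : ∀ i j → j ≢ i ⊕ -1ℤ → j ≢ i → j ≢ i ⊕ 1ℤ → Same (gen i ∷ gen j ∷ []) (gen j ∷ gen i ∷ [])
  commute-same i j p q r x with fij , fji ← far p q r =
    (λ { (u , v , _) → far-ascent⁻ fij v , far-ascent fji u , tt }) ,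
    (λ { (u , v , _) → far-ascent⁻ fji v , far-ascent fij u , tt }) ,
    λ _ → far-commute fij fji

  module Braid (2≤k : 2 ℕ.≤ k) (i : I k) where
    i′ : I k
    i′ = i ⊕ 1ℤ

    private
      r₁ : ∀ z → residue z ≡ i → residue (z + 1ℤ) ≡ i′
      r₁ z p = sym (⊕-residue z 1ℤ p)

      r₁⁻ : ∀ z → residue z ≡ i′ → residue (z - 1ℤ) ≡ i
      r₁⁻ z p = trans (residue-+1-cancel (z - 1ℤ) (ι i) (trans (cong residue (-1+1 z)) p)) (residue-ι i)

      -- The braid relation needs three consecutive residue classes to be distinct; for k = 1 the
      -- positions z and z + 2 would be congruent.
      +2-≢ : ∀ z → residue {k} (z + 1ℤ + 1ℤ) ≢ residue z
      +2-≢ z e = residue-+-≢ z 2 (ℕ.s≤s ℕ.z≤n) (ℕ.s≤s 2≤k) (trans (cong residue (lem z)) e)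
        where lem : ∀ a → a + + 2 ≡ a + 1ℤ + 1ℤ
              lem = solve-∀

    module At (z : ℤ) (p : residue z ≡ i) where
      a₀ : s i z ≡ z + 1ℤ
      a₀ = s-up z p
      a₁ : s i (z + 1ℤ) ≡ z
      a₁ = s-down z p
      a₂ : s i (z + 1ℤ + 1ℤ) ≡ z + 1ℤ + 1ℤ
      a₂ = s-fix _ (λ e → +2-≢ z (trans e (sym p)))
             (λ e → residue-+1-≢ z (trans (cong residue (sym (+1-1 (z + 1ℤ)))) (trans e (sym p))))
      b₀ : s i′ z ≡ z
      b₀ = s-fix _ (λ e → residue-+1-≢ z (trans (r₁ z p) (sym e)))
             (λ e → +2-≢ (z - 1ℤ) (trans (cong (λ y → residue (y + 1ℤ)) (-1+1 z)) (trans (r₁ z p) (sym e))))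
      b₁ : s i′ (z + 1ℤ) ≡ z + 1ℤ + 1ℤ
      b₁ = s-up (z + 1ℤ) (r₁ z p)
      b₂ : s i′ (z + 1ℤ + 1ℤ) ≡ z + 1ℤ
      b₂ = s-down _ (r₁ z p)

    -- These three inequalities are the ascents met along either side of the braid relation, in
    -- opposite orders. Hence both sides are valid from the same maps.
    Triple : (ℤ → ℤ) → Set
    Triple x = ∀ z → residue z ≡ i → x z < x (z + 1ℤ) × x z < x (z + 1ℤ + 1ℤ) × x (z + 1ℤ) < x (z + 1ℤ + 1ℤ)

    private
      back : ∀ {P : ℤ → Set} → (∀ z → residue z ≡ i → P (z + 1ℤ)) → ∀ z → residue z ≡ i′ → P z
      back {P} h z p = subst P (-1+1 z) (h (z - 1ℤ) (r₁⁻ z p))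

      p q : List (Generator k)
      p = gen i ∷ gen i′ ∷ gen i ∷ []
      q = gen i′ ∷ gen i ∷ gen i′ ∷ []

      p⇒ : ∀ {x} → Valid x p → Triple x
      p⇒ {x} (u , v , w , _) z r = u z r
        , subst₂ _<_ (cong x a₁) (cong x a₂) (v (z + 1ℤ) (r₁ z r))
        , subst₂ _<_ (cong x (trans (cong (s i) b₀) a₀)) (cong x (trans (cong (s i) b₁) a₂)) (w z r)
        where open At z r

      ⇒p : ∀ {x} → Triple x → Valid x p
      ⇒p {x} t = (λ z r → proj₁ (t z r))
        , back (λ z r → let open At z r in subst₂ _<_ (cong x (sym a₁)) (cong x (sym a₂))
            (proj₁ (proj₂ (t z r))))
        , (λ z r → let open At z r in subst₂ _<_ (cong x (sym (trans (cong (s i) b₀) a₀)))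
            (cong x (sym (trans (cong (s i) b₁) a₂))) (proj₂ (proj₂ (t z r))))
        , tt

      q⇒ : ∀ {x} → Valid x q → Triple x
      q⇒ {x} (u , v , w , _) z r =
          subst₂ _<_ (cong x (trans (cong (s i′) a₁) b₀)) (cong x (trans (cong (s i′) a₂) b₂))
              (w (z + 1ℤ) (r₁ z r))
        , subst₂ _<_ (cong x b₀) (cong x b₁) (v z r)
        , u (z + 1ℤ) (r₁ z r)
        where open At z r

      ⇒q : ∀ {x} → Triple x → Valid x q
      ⇒q {x} t = back (λ z r → proj₂ (proj₂ (t z r)))
        , (λ z r → let open At z r in subst₂ _<_ (cong x (sym b₀)) (cong x (sym b₁))
            (proj₁ (proj₂ (t z r))))
        , back (λ z r → let open At z r in subst₂ _<_ (cong x (sym (trans (cong (s i′) a₁) b₀)))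
            (cong x (sym (trans (cong (s i′) a₂) b₂))) (proj₁ (t z r)))
        , tt

      Agree : ℤ → Set
      Agree z = s i (s i′ (s i z)) ≡ s i′ (s i (s i′ z))

      agree₀ : ∀ z → residue z ≡ i → Agree z
      agree₀ z r = trans (trans (cong (s i ∘ s i′) a₀) (trans (cong (s i) b₁) a₂))
                         (sym (trans (cong (s i′ ∘ s i) b₀) (trans (cong (s i′) a₀) b₁)))
        where open At z r

      agree₁ : ∀ z → residue z ≡ i → Agree (z + 1ℤ)
      agree₁ z r = trans (trans (cong (s i ∘ s i′) a₁) (trans (cong (s i) b₀) a₀))
                         (sym (trans (cong (s i′ ∘ s i) b₁) (trans (cong (s i′) a₂) b₂)))
        where open At z r

      agree₂ : ∀ z → residue z ≡ i → Agree (z + 1ℤ + 1ℤ)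
      agree₂ z r = trans (trans (cong (s i ∘ s i′) a₂) (trans (cong (s i) b₂) a₁))
                         (sym (trans (cong (s i′ ∘ s i) b₂) (trans (cong (s i′) a₁) b₀)))
        where open At z r

      agree : ∀ z → Agree z
      agree z with moves i z
      ... | up r _ = agree₀ z r
      ... | down {y} r _ = agree₁ y r
      ... | fix _ ¬r a with moves i′ z
      ...   | up r _ = contradiction (r₁⁻ z r) ¬r
      ...   | down {y} r _ = back {λ y → Agree (y + 1ℤ)} agree₂ y r
      ...   | fix _ _ b = trans (trans (cong (s i ∘ s i′) a) (trans (cong (s i) b) a))
          (sym (trans (cong (s i′ ∘ s i) b) (trans (cong (s i′) a) b)))

    braid-same : Same p q
    braid-same x = ⇒q ∘ p⇒ , ⇒p ∘ q⇒ , λ _ → agree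

  -- In the congruence rule the right factor is tested from `x ∘ actᵍ p`, which is why `Same`
  -- quantifies over all x. For `square`, an ascent of x at i is a descent of `x ∘ s i`, so neither
  -- side is ever valid.
  ≈⇒same : ∀ {p q} → p ≈ q → Same p q
  ≈⇒same ≈-refl x = id , id , λ _ _ → refl
  ≈⇒same (≈-sym e) x with f , g , h ← ≈⇒same e x = g , f , λ v z → sym (h (g v) z)
  ≈⇒same (≈-trans e e′) x with f , g , h ← ≈⇒same e x | f′ , g′ , h′ ← ≈⇒same e′ x =
    f′ ∘ f , g ∘ g′ , λ v z → trans (h v z) (h′ (f v) z)
  ≈⇒same (++-cong {p} {p′} {q} {q′} e e′) x with f , g , h ← ≈⇒same e x =
    (λ v → let v₁ , v₂ = Valid-++⁻ p q v in
      Valid-++⁺ p′ q′ (f v₁) (Valid-cong q′ (λ z → cong x (h v₁ z)) (proj₁ (≈⇒same e′ (x ∘ actᵍ p)) v₂))) ,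
    (λ v → let v₁ , v₂ = Valid-++⁻ p′ q′ v in
      Valid-++⁺ p q (g v₁) (Valid-cong q (λ z → cong x (sym (h (g v₁) z)))
          (proj₁ (proj₂ (≈⇒same e′ (x ∘ actᵍ p′))) v₂))) ,
    (λ v z → let v₁ , v₂ = Valid-++⁻ p q v in
      trans (actᵍ-++ p q z) (trans (trans (cong (actᵍ p) (proj₂ (proj₂ (≈⇒same e′ (x ∘ actᵍ p))) v₂ z))
          (h v₁ _)) (sym (actᵍ-++ p′ q′ z))))
  ≈⇒same (zeroˡ g) x = (λ ()) , (λ ()) , λ ()
  ≈⇒same (zeroʳ (gen i)) x = (λ { (_ , ()) }) , (λ ()) , λ { (_ , ()) }
  ≈⇒same (zeroʳ 𝟎) x = (λ ()) , (λ ()) , λ ()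
  ≈⇒same (square i) x = ⊥-elim ∘ invalid , (λ ()) , λ v → ⊥-elim (invalid v)
    where
    invalid : ¬ Valid x (gen i ∷ gen i ∷ [])
    invalid (u , v , _) = ℤ.<-asym (u (ι i) r)
        (subst₂ _<_ (cong x (s-up (ι i) r)) (cong x (s-down (ι i) r)) (v (ι i) r))
      where
      r : residue (ι i) ≡ i
      r = residue-ι i
  ≈⇒same (commute i j p q r) = commute-same i j p q r
  ≈⇒same (braid 2≤k i) = Braid.braid-same 2≤k i

  -- Induction on the last letter i. A word v acting as w followed by i has a descent where w has
  -- its ascent, so `deletion` yields a word one letter shorter than v that acts as w.
  valid⇒reduced : ∀ (w : Word k) → Valid id (map gen w) → Reduced w
  valid⇒reduced w = go (reverseView w)
    where
    go : ∀ {w : Word k} → Reverse w → Valid id (map gen w) → Reduced w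
    go [] val v e = ℕ.z≤n
    go (w ∶ rw ∶ʳ i) val v e with val₁ , asc , _ ← Valid-++⁻ (map gen w) (gen i ∷ [])
        (subst (Valid id) (List.map-++ gen w (i ∷ [])) val)
      with v′ , l , e′ ← deletion v i (ι i) (residue-ι i)
        (subst₂ _<_ (trans (actᵍ-map w (ι i))
            (trans (sym (trans (act-++ w (i ∷ []) (ι i + 1ℤ))
            (cong (act w) (s-down (ι i) (residue-ι i))))) (sym (e _))))
                    (trans (actᵍ-map w (ι i + 1ℤ)) (trans
                        (sym (trans (act-++ w (i ∷ []) (ι i)) (cong (act w) (s-up (ι i) (residue-ι i)))))
                        (sym (e _))))
          (asc (ι i) (residue-ι i)))
      = ℕ.≤-trans (ℕ.≤-reflexive (trans (List.length-++ w) (ℕ.+-comm (length w) 1)))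
          (ℕ.≤-trans (ℕ.s≤s (go rw val₁ v′ λ z → trans (e′ z)
              (trans (e (s i z)) (trans (act-++ w (i ∷ []) (s i z)) (cong (act w) (s-involutive i z))))))
            (ℕ.≤-reflexive l))

  -- If i met a descent after v, `deletion` would absorb i into v while removing a letter of v. The
  -- whole word would then become shorter by two letters with the same action.
  reduced⇒valid-from : ∀ (v w : Word k) → Reduced (v ++ w) → Valid (act v) (map gen w)
  reduced⇒valid-from v []      red = tt
  reduced⇒valid-from v (i ∷ w) red = asc ,
    Valid-cong (map gen w) (λ z → act-++ v (i ∷ []) z)
      (reduced⇒valid-from (v ++ i ∷ []) w (subst Reduced (sym (List.++-assoc v (i ∷ []) w)) red))
    where
    asc : Ascent (act v) i
    asc z r with act v z ℤ.<? act v (z + 1ℤ)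
    ... | yes lt = lt
    ... | no ≮ with v′ , l , e ← deletion v i z r
        (ℤ.≤∧≢⇒< (ℤ.≮⇒≥ ≮) λ e → ℤ.<⇒≢ (<+1 z) (sym (act-injective v e))) =
      contradiction (red (v′ ++ w) λ y → trans (act-++ v′ w y)
          (trans (e (act w y)) (sym (act-++ v (i ∷ w) y))))
        (ℕ.<⇒≱ (begin-strict
          length (v′ ++ w)             ≡⟨ List.length-++ v′ ⟩
          length v′ ℕ.+ length w       <⟨ ℕ.n<1+n _ ⟩
          suc (length v′) ℕ.+ length w ≡⟨ cong (ℕ._+ length w) l ⟩
          length v ℕ.+ length w        ≤⟨ ℕ.+-monoʳ-≤ (length v) (ℕ.n≤1+n (length w)) ⟩
          length v ℕ.+ length (i ∷ w)  ≡⟨ List.length-++ v ⟨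
          length (v ++ i ∷ w)          ∎))
      where open ℕ.≤-Reasoning

  reduced⇒valid : ∀ (w : Word k) → Reduced w → Valid id (map gen w)
  reduced⇒valid w = reduced⇒valid-from [] w

  represents⁺ : ∀ {w : Word k} {x} → Reduced w → (∀ z → act w z ≡ to x z) → map gen w Represents x
  represents⁺ {w} red e = w , red , e , ≈-refl

  -- The definition supplies some reduced word congruent to w. Validity passes along the congruence,
  -- so w itself is reduced.
  represents⁻ : ∀ {w : Word k} {x} → map gen w Represents x → Reduced w × (∀ z → act w z ≡ to x z)
  represents⁻ {w} (v , red , e , eq) with f , g , h ← ≈⇒same eq id =
    valid⇒reduced w val , λ z → trans (sym (actᵍ-map w z)) (trans (h val z) (trans (actᵍ-map v z) (e z)))
    where
    val : Valid id (map gen w)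
    val = g (reduced⇒valid v red)

  -- The words of u_A

  infix 4 _⊲_

  -- b may stand to the right of c in the word of u_A.
  _⊲_ : I k → I k → Set
  c ⊲ b = b ≢ c × b ≢ c ⊕ -1ℤ

  Ordered : Word k → Set
  Ordered = AllPairs _⊲_

  after : ∀ {i w} y → Ordered (i ∷ w) → residue y ≡ i → residue {k} y ∉ˡ w × residue {k} (y - 1ℤ) ∉ˡ w
  after {i} {w} y (i⊲ ∷ _) refl =
    (λ m → proj₁ (All.lookup i⊲ m) refl) ,
    (λ m → proj₂ (All.lookup i⊲ m) (sym (residue-⊕ y -1ℤ)))

  after-pred : ∀ {i w} y → Ordered (i ∷ w) → residue y ≡ i → residue {k} (y - 1ℤ) ∉ˡ i ∷ w
  after-pred y o p (here e) = residue--1-≢ y (trans e (sym p))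
  after-pred y o p (there m) = proj₂ (after y o p) m

  act-fix : ∀ w z → residue z ∉ˡ w → residue (z - 1ℤ) ∉ˡ w → act {k} w z ≡ z
  act-fix []      z p q = refl
  act-fix (i ∷ w) z p q = trans (cong (s i) (act-fix w z (p ∘ there) (q ∘ there)))
      (s-fix z (p ∘ here) (q ∘ here))

  -- The rightmost letter acts first and c stands to the left of c + 1. When its own letter c lifts
  -- the point z to z + 1, the letter c + 1 has already gone by, so the point is not lifted again.
  act-up : ∀ {w} z → Ordered w → residue z ∈ˡ w → act {k} w z ≡ z + 1ℤ
  act-up {i ∷ w} z o (here p) with ¬m , ¬m′ ← after z o p =
    trans (cong (s i) (act-fix w z ¬m ¬m′)) (s-up z p)
  act-up {i ∷ w} z o@(_ ∷ o′) (there m) = trans (cong (s i) (act-up z o′ m))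
    (s-fix (z + 1ℤ) (λ e → proj₂ (after (z + 1ℤ) o e) (subst (λ y → residue y ∈ˡ w) (sym (+1-1 z)) m))
                    (λ e → proj₁ (after z o (trans (cong residue (sym (+1-1 z))) e)) m))

  record Block (w : Word k) (t j : ℤ) : Set where
    field
      t≤j     : t ≤ j
      between : ∀ y → t ≤ y → y < j → residue y ∈ˡ w
      end     : residue j ∉ˡ w

  -- The word is read from the left, hence backwards in time, from the final position t. A leading
  -- letter congruent to t shows that the point came down from t + 1, which lengthens the run; the
  -- hypothesis on t - 1 excludes that it came up from there.
  block : ∀ {w} t j → Ordered w → residue (t - 1ℤ) ∉ˡ w → act {k} w j ≡ t → Block w t j
  block {[]} t j o p refl = record { t≤j = ℤ.≤-refl ; between = λ y t≤y y<t → contradiction t≤y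
      (ℤ.<⇒≱ y<t) ; end = λ () }
  block {i ∷ w} t j o@(_ ∷ o′) p e with moves i t
  ... | down {y} q _ = contradiction (here (trans (cong residue (+1-1 y)) q)) p
  ... | up q e′ = record
    { t≤j = ℤ.≤-trans (ℤ.<⇒≤ (<+1 t)) B.t≤j ; between = between ; end = end }
    where
    module B = Block (block (t + 1ℤ) j o′
        (subst (λ y → residue y ∉ˡ w) (sym (+1-1 t)) (proj₁ (after t o q)))
      (trans (sym (s-involutive i (act w j))) (trans (cong (s i) e) e′)))
    between : ∀ y → t ≤ y → y < j → residue y ∈ˡ i ∷ w
    between y t≤y y<j with ≤-split t≤y
    ... | inj₁ refl = here q
    ... | inj₂ t<y  = there (B.between y t<y y<j)
    end : residue j ∉ˡ i ∷ w
    end (there m) = B.end m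
    end (here r) with ≤-split (<+1⇒≤ (subst (t <_) (sym (-1+1 j)) (ℤ.<-≤-trans (<+1 t) B.t≤j)))
    ... | inj₁ t≡ = residue--1-≢ j (trans (cong residue (sym t≡)) (trans q (sym r)))
    ... | inj₂ t< = proj₂ (after j o r) (B.between (j - 1ℤ) t< (-1< j))
  ... | fix q _ e′ = record { t≤j = B.t≤j ; between = λ y l u → there (B.between y l u) ; end = end }
    where
    module B = Block (block t j o′ (p ∘ there)
        (trans (sym (s-involutive i (act w j))) (trans (cong (s i) e) e′)))
    end : residue j ∉ˡ i ∷ w
    end (there m) = B.end m
    end (here r) with ≤-split B.t≤j
    ... | inj₁ refl = q r
    ... | inj₂ t<j  = proj₂ (after j o r)
      (B.between (j - 1ℤ) (<+1⇒≤ (ℤ.<-≤-trans (<+1 t) (subst (t + 1ℤ ≤_) (sym (-1+1 j)) t<j))) (-1< j))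

  -- If the position just below the image were a letter, `act-up` would send it to the same image as
  -- z. By injectivity it would be z, which is no letter.
  act-down : ∀ {w} z → Ordered w → residue z ∉ˡ w → residue (act {k} w z - 1ℤ) ∉ˡ w × Block w (act w z) z
  act-down {w} z o p = q , block (act w z) z o q refl
    where
    q : residue (act w z - 1ℤ) ∉ˡ w
    q m = p (subst (λ y → residue y ∈ˡ w)
        (act-injective w (trans (act-up (act w z - 1ℤ) o m) (-1+1 (act w z)))) m)

  -- The image of z is z + 1 or the start of the run of letters ending below z, and both depend on
  -- the set of letters alone. Were one of two candidate starts lower, the position below the higher
  -- one would be a letter for one word and not for the other.
  act-unique : ∀ {v w} → Ordered v → Ordered w → (∀ i → i ∈ˡ v ⇔ i ∈ˡ w) → ∀ z → act v z ≡ act {k} w z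
  act-unique {v} {w} o o′ vw z with residue z ∈ˡ? v
  ... | yes m = trans (act-up z o m) (sym (act-up z o′ (⇒ (vw _) m)))
  ... | no ¬m with p , b ← act-down z o ¬m | q , c ← act-down z o′ (¬m ∘ ⇐ (vw _)) =
    ℤ.≤-antisym (ℤ.≮⇒≥ λ lt → p (⇐ (vw _) (before b c lt))) (ℤ.≮⇒≥ λ lt → q (⇒ (vw _) (before c b lt)))
    where
    before : ∀ {v w t t′} → Block v t z → Block w t′ z → t′ < t → residue (t - 1ℤ) ∈ˡ w
    before {t = t} {t′} b c lt = Block.between c (t - 1ℤ) (<+1⇒≤ (subst (t′ <_) (sym (-1+1 t)) lt))
      (ℤ.<-≤-trans (-1< t) (Block.t≤j b))

  -- For f = x ∘ act (i ∷ w), the word sends j to z and z to z + 1. The ascent of x at the leading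
  -- letter therefore reads f j < f z: this j is the partner of z in an inversion of f.
  act-first : ∀ {i w} z → Ordered (i ∷ w) → residue z ≡ i → let j = act (reverse (i ∷ w)) z in
    act {k} w j ≡ z + 1ℤ × z < j × Block (i ∷ w) z j
  act-first {i} {w} z o p = wj , ℤ.≤∧≢⇒< (Block.t≤j b)
      (λ z≡j → Block.end b (subst (λ y → residue y ∈ˡ i ∷ w) z≡j (here p))) , b
    where
    j = act (reverse (i ∷ w)) z
    ij : act (i ∷ w) j ≡ z
    ij = act-reverseʳ (i ∷ w) z
    wj : act w j ≡ z + 1ℤ
    wj = trans (sym (s-involutive i _)) (trans (cong (s i) ij) (s-up z p))
    b : Block (i ∷ w) z j
    b = block z j o (after-pred z o p) ij

  -- Q holds of the letters of the whole word of which w is a final segment.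
  ordered⇒valid : ∀ w {x f : ℤ → ℤ} (Q : I k → Set) → Ordered w → (∀ z → f z ≡ x (act w z)) →
    (∀ i → Q i → i ∈ˡ w ⊎ i ⊕ -1ℤ ∉ˡ w) →
    (∀ z j → z < j → residue z ∈ˡ w → (∀ y → z ≤ y → y < j → residue y ∈ˡ w) → ¬ Q (residue j) →
        f j < f z) →
    Valid x (map gen w)
  ordered⇒valid []      Q o f≡ split h = tt
  ordered⇒valid (i ∷ w) {x} {f} Q o@(i⊲ ∷ o′) f≡ split h = ascent ,
    ordered⇒valid w Q o′ f≡ split′ (λ z j z<j m b → h z j z<j (there m) (λ y l u → there (b y l u)))
    where
    -- A predecessor stands to the left, so once i has been read, i - 1 cannot be among the
    -- remaining letters. Hence a run of remaining letters ends at a position outside the whole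
    -- word.
    split′ : ∀ c → Q c → c ∈ˡ w ⊎ c ⊕ -1ℤ ∉ˡ w
    split′ c q with split c q
    ... | inj₁ (here refl) = inj₂ (λ m → proj₂ (All.lookup i⊲ m) refl)
    ... | inj₁ (there m) = inj₁ m
    ... | inj₂ ¬m = inj₂ (¬m ∘ there)
    ascent : Ascent x i
    ascent z p with wj , z<j , b ← act-first z o p =
      subst₂ _<_ (trans (f≡ j) (cong x (act-reverseʳ (i ∷ w) z)))
          (trans (f≡ z) (cong x (act-up z o (here p))))
        (h z j z<j (here p) (Block.between b) λ q → [ Block.end b ,
            (λ ¬m → ¬m (subst (_∈ˡ i ∷ w) (sym (residue-⊕ j -1ℤ)) j-1∈)) ]′ (split (residue j) q))
      where
      j = act (reverse (i ∷ w)) z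
      j-1∈ : residue (j - 1ℤ) ∈ˡ i ∷ w
      j-1∈ = Block.between b (j - 1ℤ) (<+1⇒≤ (subst (z <_) (sym (-1+1 j)) z<j)) (-1< j)

  Inversion : (ℤ → ℤ) → ℤ → ℤ → Set
  Inversion f z j = (z < j) × (f j < f z)

  -- The upper bound on a first factor: the ascent tested at a letter is an inversion of f starting
  -- at the positions of that letter.
  valid⇒inversion : ∀ {w} {x f : ℤ → ℤ} → Ordered w → (∀ z → f z ≡ x (act {k} w z)) → Valid x (map gen w) →
    ∀ z → residue z ∈ˡ w → ∃ (Inversion f z)
  valid⇒inversion {i ∷ w} {x} o f≡ (asc , _) z (here p) with wj , z<j , b ← act-first z o p =
    _ , z<j , subst₂ _<_ (sym (trans (f≡ _) (cong x (act-reverseʳ (i ∷ w) z))))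
        (sym (trans (f≡ z) (cong x (act-up z o (here p))))) (asc z p)
  valid⇒inversion {i ∷ w} o@(_ ∷ o′) f≡ (_ , v) z (there m) = valid⇒inversion o′ f≡ v z m

  -- The content of `Increasing`, with the order condition put on pairs of entries of the word so
  -- that inductions along the word can pass to tails.
  record Spells (A : Subset (suc k)) (w : Word k) : Set where
    field
      ordered : Ordered w
      letters : ∀ i → i ∈ˡ w ⇔ i ∈ A

  increasing⇒spells : ∀ {A w} → Increasing A w → Spells A w
  increasing⇒spells {A} {w} (once , sub) = record
    { letters = once.letters ; ordered = go w once.unique λ j m m′ → sub j (⇒ (once.letters _) m)
        (⇒ (once.letters _) m′) }
    where
    module once = EachOnce once
    go : ∀ w → Unique w → (∀ j → j ∈ˡ w → j ⊕ -1ℤ ∈ˡ w → j ⊕ -1ℤ ∷ j ∷ [] ⊆ w) → Ordered w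
    go []      _ _ = []
    go (i ∷ w) (i≢ ∷ u) sub = All.tabulate
        (λ {b} m → (λ e → All.lookup i≢ m (sym e)) , λ e → bad (subst (_∈ˡ w) e m)) ∷
      go w u (λ j m m′ → tail j m m′ (sub j (there m) (there m′)))
      where
      bad : i ⊕ -1ℤ ∉ˡ w
      bad m with sub i (here refl) (there m)
      ... | e ∷ _ = residue--1-≢ (ι i) (trans e (sym (residue-ι i)))
      ... | _ ∷ʳ τ = All.lookup i≢ (to∈ (tail′ τ)) refl
        where
        tail′ : ∀ {c d} {v : Word k} → c ∷ d ∷ [] ⊆ v → d ∷ [] ⊆ v
        tail′ (y ∷ʳ τ) = y ∷ʳ tail′ τ
        tail′ (e ∷ τ) = _ ∷ʳ τ
      tail : ∀ j → j ∈ˡ w → j ⊕ -1ℤ ∈ˡ w → j ⊕ -1ℤ ∷ j ∷ [] ⊆ i ∷ w → j ⊕ -1ℤ ∷ j ∷ [] ⊆ w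
      tail j m m′ (e ∷ _) = contradiction (sym e) (All.lookup i≢ m′)
      tail j m m′ (_ ∷ʳ τ) = τ

  spells⇒increasing : ∀ {A w} → Spells A w → Increasing A w
  spells⇒increasing {A} {w} sp = record { unique = AllPairs.map
      (λ p e → proj₁ p (sym e)) S.ordered ; letters = S.letters } ,
    λ j m m′ → go w S.ordered j (⇐ (S.letters _) m) (⇐ (S.letters _) m′)
    where
    module S = Spells sp
    go : ∀ w → Ordered w → ∀ j → j ∈ˡ w → j ⊕ -1ℤ ∈ˡ w → j ⊕ -1ℤ ∷ j ∷ [] ⊆ w
    go (i ∷ w) (i⊲ ∷ o) j (here refl) (here e) = contradiction (trans e (sym (residue-ι j)))
        (residue--1-≢ (ι j))
    go (i ∷ w) (i⊲ ∷ o) j (here refl) (there m) = contradiction refl (proj₂ (All.lookup i⊲ m))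
    go (i ∷ w) (i⊲ ∷ o) j (there m) (here e) = e ∷ from∈ m
    go (i ∷ w) (i⊲ ∷ o) j (there m) (there m′) = i ∷ʳ go w o j m m′

  residue-apart : ∀ z {m n} → m ℕ.< n → n ℕ.< m ℕ.+ suc k → residue {k} (z + + n) ≢ residue (z + + m)
  residue-apart z {m} {n} m<n n<m+N e = residue-+-≢ (z + + m) (n ℕ.∸ m) (ℕ.m<n⇒0<n∸m m<n)
    (ℕ.+-cancelˡ-< m _ _ (subst (ℕ._< m ℕ.+ suc k) (sym (ℕ.m+[n∸m]≡n (ℕ.<⇒≤ m<n))) n<m+N))
    (trans (cong residue (trans (ℤ.+-assoc z (+ m) (+ (n ℕ.∸ m)))
        (cong (λ d → z + + d) (ℕ.m+[n∸m]≡n (ℕ.<⇒≤ m<n))))) e)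

  residue-onto : ∀ z (i : I k) → ∃ λ t → t ℕ.< suc k × i ≡ residue (z + + t)
  residue-onto z i = toℕ r , Fin.toℕ<n r , (begin
    i                                              ≡⟨ residue-ι i ⟨
    residue (ι i)                                  ≡⟨ cong residue (lem z (ι i)) ⟩
    residue (z + (ι i - z))                        ≡⟨ cong (λ y → residue (z + y))
        (residue-split (ι i - z)) ⟩
    residue (z + (ι r + ((ι i - z) /ℕ suc k) * N)) ≡⟨ cong residue
        (ℤ.+-assoc z (ι r) (((ι i - z) /ℕ suc k) * N)) ⟨
    residue (z + ι r + ((ι i - z) /ℕ suc k) * N)   ≡⟨ residue-shift (z + ι r) ((ι i - z) /ℕ suc k) ⟩
    residue (z + ι r)                              ∎)
    where
    open ≡-Reasoning
    r : I k
    r = residue (ι i - z)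
    lem : ∀ b c → c ≡ b + (c - b)
    lem = solve-∀

  -- Once around the circle from a missing residue b, the letters b + 1, ..., b + k have every
  -- predecessor on their left. The one predecessor that would wrap around is that of b + 1, namely
  -- b.
  spelling : ∀ A → A ⊂ full → ∃ (Spells A)
  spelling A (_ , b , _ , b∉A) = filter (_∈? A) enum , record
    { ordered = AllPairs.filter⁺ (_∈? A) (AllPairs.applyUpTo⁺₁ letter k ord)
    ; letters = λ i → mk⇔ (proj₂ ∘ ∈-filter⁻ (_∈? A) {xs = enum})
        (λ m → ∈-filter⁺ (_∈? A) (complete i m) m) }
    where
    letter : ℕ → I k
    letter t = residue (ι b + + suc t)
    enum : Word k
    enum = applyUpTo letter k
    lem₁ : ∀ b m → b + (1ℤ + m) + -1ℤ ≡ b + m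
    lem₁ = solve-∀
    ord : ∀ {m n} → m ℕ.< n → n ℕ.< k → letter m ⊲ letter n
    ord {m} {n} m<n n<k =
      residue-apart (ι b) (ℕ.s≤s m<n)
          (ℕ.s≤s (ℕ.<-≤-trans n<k (ℕ.≤-trans (ℕ.n≤1+n k) (ℕ.m≤n+m (suc k) m)))) ,
      λ e → residue-apart (ι b) (ℕ.m<n⇒m<1+n m<n) (ℕ.≤-trans (ℕ.s≤s n<k) (ℕ.m≤n+m (suc k) m))
        (trans e (trans (residue-⊕ (ι b + + suc m) -1ℤ) (cong residue (lem₁ (ι b) (+ m)))))
    complete : ∀ i → i ∈ A → i ∈ˡ enum
    complete i i∈A with residue-onto (ι b) i
    ... | 0 , _ , e = contradiction
        (subst (_∈ A) (trans e (trans (cong residue (ℤ.+-identityʳ (ι b))) (residue-ι b))) i∈A) b∉A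
    ... | suc t , ℕ.s≤s t<k , refl = ∈-applyUpTo⁺ letter t<k

  -- Inversions of a product with u_A

  record Affine (f : ℤ → ℤ) : Set where
    constructor affine
    field
      periodicity : Periodic f
      injectivity : Injective f
  open Affine public

  Inversions : (ℤ → ℤ) → ℤ → Set
  Inversions f z = ∃ (Inversion f z)

  inversions-≡ : ∀ {f z} {p q : Inversions f z} → proj₁ p ≡ proj₁ q → p ≡ q
  inversions-≡ {p = j , l , m} {.j , l′ , m′} refl = cong₂ (λ x y → j , x , y) (ℤ.<-irrelevant l l′)
      (ℤ.<-irrelevant m m′)

  inversion-shift : ∀ {f z j} → Periodic f → ∀ q → Inversion f z j → Inversion f (z + q * N) (j + q * N)
  inversion-shift {f} {z} {j} per q (l , m) = ℤ.+-monoˡ-< (q * N) l ,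
    subst₂ _<_ (sym (per j q)) (sym (per z q)) (ℤ.+-monoˡ-< (q * N) m)

  inversions-residue : ∀ {f} → Periodic f → ∀ y z → residue {k} y ≡ residue z → Inversions f y →
      Inversions f z
  inversions-residue per y z e (j , inv) with q , refl ← residue-≡⇒ z y (sym e) = j + q * N ,
      inversion-shift per q inv

  inversion-trans : ∀ {f x y z} → Inversion f x y → Inversion f y z → Inversion f x z
  inversion-trans (l , m) (l′ , m′) = ℤ.<-trans l l′ , ℤ.<-trans m′ m

  Bounded : (ℤ → ℤ) → ℕ → Set
  Bounded f D = ∀ z j → Inversion f z j → j ≤ z + + D

  inversions? : ∀ {f D} → Bounded f D → ∀ z → Dec (Inversions f z)
  inversions? {f} {D} bound z = map′
    (λ { (n , _ , inv) → z + + n , inv })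
    (λ { (j , inv) → search j inv })
    (ℕ.anyUpTo? (λ n → (z ℤ.<? z + + n) ×-dec (f (z + + n) ℤ.<? f z)) (suc D))
    where
    search : ∀ j → Inversion f z j → ∃ λ n → n ℕ.< suc D × Inversion f z (z + + n)
    search j inv with n , refl ← ≤⇒+ (ℤ.<⇒≤ (proj₁ inv)) =
      n , ℕ.s≤s (ℤ.drop‿+≤+ (+-cancelˡ-≤ z (bound z j inv))) , inv
      where
      lem : ∀ z a → - z + (z + a) ≡ a
      lem = solve-∀
      +-cancelˡ-≤ : ∀ z {a b} → z + a ≤ z + b → a ≤ b
      +-cancelˡ-≤ z {a} {b} l = subst₂ _≤_ (lem z a) (lem z b) (ℤ.+-monoʳ-≤ (- z) l)

  subset : ∀ {n} {P : Fin n → Set} → (∀ i → Dec (P i)) → Subset n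
  subset P? = Vec.tabulate (λ i → does (P? i))

  ∈-subset : ∀ {n} {P : Fin n → Set} (P? : ∀ i → Dec (P i)) i → i ∈ subset P? ⇔ P i
  ∈-subset P? i = mk⇔
    (λ m → dec⁻ (P? i) (trans (sym (Vec.lookup∘tabulate _ i)) (Vec.[]=⇒lookup m)))
    (λ p → Vec.lookup⇒[]= i _ (trans (Vec.lookup∘tabulate _ i) (dec-true (P? i) p)))
    where
    dec⁻ : ∀ {P : Set} (d : Dec P) → does d ≡ true → P
    dec⁻ (yes p) _ = p

  -- A chain of inversions starting at 0 ends at a point without inversions.
  inversion-free : ∀ {f D} → Bounded f D → ∃ λ z → ¬ Inversions f z
  inversion-free {f} {D} bound = go (suc D) 0ℤ (inj₁ refl) ℤ.≤-refl
    where
    -- Invariant: z has moved at least `suc D` minus n beyond 0. When the fuel n is used up, the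
    -- inversion from 0 to z is longer than the bound D allows.
    go : ∀ n z → z ≡ 0ℤ ⊎ Inversion f 0ℤ z → 0ℤ + + suc D ≤ z + + n → ∃ λ z → ¬ Inversions f z
    go n z reached le with inversions? bound z
    ... | no none = z , none
    go 0 z (inj₁ refl) le | yes _ with () ← ℤ.drop‿+≤+ le
    go 0 z (inj₂ inv) le | yes _ =
      contradiction (ℤ.≤-trans le (ℤ.≤-trans (ℤ.≤-reflexive (ℤ.+-identityʳ z)) (bound 0ℤ z inv)))
          (ℕ.<⇒≱ (ℕ.n<1+n D) ∘ ℤ.drop‿+≤+)
    go (suc n) z reached le | yes (j , inv) = go n j (inj₂ (chain reached))
      (ℤ.≤-trans le (ℤ.≤-trans (ℤ.≤-reflexive (+-1+ z (+ n))) (ℤ.+-monoˡ-≤ (+ n) (<⇒+1≤ (proj₁ inv)))))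
      where
      chain : z ≡ 0ℤ ⊎ Inversion f 0ℤ z → Inversion f 0ℤ j
      chain (inj₁ refl) = inv
      chain (inj₂ inv′) = inversion-trans inv′ inv

  -- Removing the increasing factor on the set of inversion starts

  module Peel {f g : ℤ → ℤ} {A : Subset (suc k)} {w : Word k}
    (aff : Affine f) (spells : Spells A w) (support : ∀ z → residue z ∈ A ⇔ Inversions f z)
        (f≡ : ∀ z → f z ≡ g (act w z))
    where

    private
      ordered = Spells.ordered spells
      u = act w
      u⁻¹ = act (reverse w)

      up′ : ∀ z → residue z ∈ A → u z ≡ z + 1ℤ
      up′ z m = act-up z ordered (⇐ (Spells.letters spells _) m)

      module Down z (m : residue z ∉ A) where
        private
          d = act-down z ordered (m ∘ ⇒ (Spells.letters spells _))
        start : residue (u z - 1ℤ) ∉ A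
        start = proj₁ d ∘ ⇐ (Spells.letters spells _)
        ≤z : u z ≤ z
        ≤z = Block.t≤j (proj₂ d)
        between : ∀ y → u z ≤ y → y < z → residue y ∈ A
        between y l m = ⇒ (Spells.letters spells _) (Block.between (proj₂ d) y l m)

      g≡ : ∀ z → g z ≡ f (u⁻¹ z)
      g≡ z = sym (trans (f≡ (u⁻¹ z)) (cong g (act-reverseʳ w z)))

    affine-peel : Affine g
    affine-peel = affine
      (λ z q → trans (g≡ _) (trans (trans (cong f (act-periodic (reverse w) z q)) (periodicity aff _ q))
          (cong (_+ q * N) (sym (g≡ z)))))
      (λ {y} {z} e → act-injective (reverse w) (injectivity aff (trans (sym (g≡ y)) (trans e (g≡ z)))))

    -- Follow inversions upwards from z; the values fall. A step landing before j is still in the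
    -- run and can be continued. A step to some i beyond j has f j < f i, because j starts no
    -- inversion. The distance from z to j serves as fuel.
    run-end : ∀ z j → z < j → (∀ y → z ≤ y → y < j → residue y ∈ A) → residue j ∉ A → f j < f z
    run-end z j z<j = go ∣ j - z ∣ z
        (ℤ.≤-reflexive (trans (lem z j) (cong (λ x → z + x) (sym (ℤ.0≤i⇒+∣i∣≡i (≤⇒0≤ (ℤ.<⇒≤ z<j))))))) z<j
      where
      lem : ∀ z j → j ≡ z + (j - z)
      lem = solve-∀
      go : ∀ n z → j ≤ z + + n → z < j → (∀ y → z ≤ y → y < j → residue y ∈ A) → residue j ∉ A → f j < f z
      go 0 z le z<j = contradiction (subst (j ≤_) (ℤ.+-identityʳ z) le) (ℤ.<⇒≱ z<j)
      go (suc n) z le z<j run ¬m with i , z<i , fi<fz ← ⇒ (support z) (run z ℤ.≤-refl z<j) with ℤ.<-cmp i j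
      ... | tri≈ _ refl _ = fi<fz
      ... | tri> _ _ j<i = ℤ.<-trans (ℤ.≤∧≢⇒< (ℤ.≮⇒≥ λ lt → ¬m (⇐ (support j) (i , j<i , lt)))
          (ℤ.<⇒≢ j<i ∘ injectivity aff)) fi<fz
      ... | tri< i<j _ _ = ℤ.<-trans
        (go n i (ℤ.≤-trans le (ℤ.≤-trans (ℤ.≤-reflexive (+-1+ z (+ n)))
            (ℤ.+-monoˡ-≤ (+ n) (<⇒+1≤ z<i)))) i<j (λ y l → run y (ℤ.≤-trans (ℤ.<⇒≤ z<i) l)) ¬m) fi<fz

    valid : Valid g (map gen w)
    valid = ordered⇒valid w (_∈ A) ordered f≡ (λ i m → inj₁ (⇐ (Spells.letters spells i) m))
      (λ z j z<j _ run → run-end z j z<j (λ y l m → ⇒ (Spells.letters spells _) (run y l m)))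

    run-unique : ∀ z h j → z ≤ h → (∀ y → z ≤ y → y < h → residue y ∈ A) → residue h ∉ A → z ≤ j →
        (∀ y → z ≤ y → y < j → residue y ∈ A) → residue j ∉ A → j ≡ h
    run-unique z h j z≤h run ¬m z≤j run′ ¬m′ = ℤ.≤-antisym (ℤ.≮⇒≥ λ h<j → ¬m (run′ h z≤h h<j))
        (ℤ.≮⇒≥ λ j<h → ¬m′ (run j z≤j j<h))

    -- `u` raises a point by at most 1, so an image beyond z + 1 has its preimage beyond z.
    inversion⁻ : ∀ z y → residue z ∈ A → Inversion g (z + 1ℤ) y → Inversion f z (u⁻¹ y)
    inversion⁻ z y m (l , lt) = z<j , subst₂ _<_ (g≡ y) (trans (cong g (sym (up′ z m))) (sym (f≡ z))) lt
      where
      z<j : z < u⁻¹ y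
      z<j with residue (u⁻¹ y) ∈? A
      ... | yes m′ = +1≤⇒< (<+1⇒≤ (subst (z + 1ℤ <_) (trans (sym (act-reverseʳ w y)) (up′ (u⁻¹ y) m′)) l))
      ... | no m′ = ℤ.<-trans (<+1 z)
          (ℤ.<-≤-trans l (subst (_≤ u⁻¹ y) (act-reverseʳ w y) (Down.≤z (u⁻¹ y) m′)))

    -- The preimage i of z + 1 lies outside A and is the end of the run starting at z + 1. An end j
    -- beyond i would make i an inversion start; an end j inside the run has f i < f j by `run-end`.
    inversion-free-peel : ∀ z → residue z ∉ A → ¬ Inversions g (z + 1ℤ)
    inversion-free-peel z z∉A (y , z+1<y , gy<) = bad
      where
      i = u⁻¹ (z + 1ℤ)
      j = u⁻¹ y
      ui : u i ≡ z + 1ℤ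
      ui = act-reverseʳ w (z + 1ℤ)
      uj : u j ≡ y
      uj = act-reverseʳ w y
      i∉A : residue i ∉ A
      i∉A m = z∉A (subst (λ x → residue x ∈ A)
          (trans (sym (+1-1 i)) (trans (cong (_- 1ℤ) (trans (sym (up′ i m)) ui)) (+1-1 z))) m)
      fj<fi : f j < f i
      fj<fi = subst₂ _<_ (g≡ y) (g≡ (z + 1ℤ)) gy<
      z<j : z + 1ℤ ≤ j
      z<j with residue j ∈? A
      ... | yes m = <+1⇒≤ (subst (z + 1ℤ <_) (trans (sym uj) (up′ j m)) z+1<y)
      ... | no m = ℤ.≤-trans (ℤ.<⇒≤ z+1<y) (subst (_≤ j) uj (Down.≤z j m))
      bad : ⊥
      bad with ℤ.<-cmp i j
      ... | tri< i<j _ _ = i∉A (⇐ (support i) (j , i<j , fj<fi))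
      ... | tri≈ _ i≡j _ = ℤ.<⇒≢ fj<fi (cong f (sym i≡j))
      ... | tri> _ _ j<i = ℤ.<-asym fj<fi (run-end j i j<i
        (λ x l → Down.between i i∉A x (ℤ.≤-trans (ℤ.≤-reflexive ui) (ℤ.≤-trans z<j l))) i∉A)

    -- The start moves from z to z + 1, so the end y must stay within the old bound. If `u` lifted
    -- the end, then `u⁻¹ y` is in A and starts a further inversion; its end is at least y, and by
    -- transitivity it is the end of an inversion starting at z.
    bounded-peel : ∀ {D} → Bounded f (suc D) → Bounded g D
    bounded-peel {D} bound z′ y inv = subst (λ x → y ≤ x + + D) (-1+1 z′)
        (go (z′ - 1ℤ) (subst (λ x → Inversion g x y) (sym (-1+1 z′)) inv))
      where
      go : ∀ z → Inversion g (z + 1ℤ) y → y ≤ z + 1ℤ + + D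
      go z inv with residue z ∈? A
      ... | no m = contradiction (y , inv) (inversion-free-peel z m)
      ... | yes m with inv′ ← inversion⁻ z y m inv | residue (u⁻¹ y) ∈? A
      ...   | no m′ = ℤ.≤-trans (subst (_≤ u⁻¹ y) (act-reverseʳ w y) (Down.≤z (u⁻¹ y) m′))
                (ℤ.≤-trans (bound z _ inv′) (ℤ.≤-reflexive (+-1+ z (+ D))))
      ...   | yes m′ with i , inv″ ← ⇒ (support _) m′ =
                ℤ.≤-trans (ℤ.≤-reflexive (trans (sym (act-reverseʳ w y)) (up′ _ m′)))
                  (ℤ.≤-trans (<⇒+1≤ (proj₁ inv″))
                      (ℤ.≤-trans (bound z i (inversion-trans inv′ inv″)) (ℤ.≤-reflexive (+-1+ z (+ D)))))

    next-outside : ∀ t z → residue (z + + t) ∉ A → ∃ λ h → z ≤ h × (∀ y → z ≤ y → y < h → residue y ∈ A) ×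
        residue h ∉ A
    next-outside t z ¬m = go t (residue z ∈? A) ¬m
      where
      Next : ℤ → Set
      Next z = ∃ λ h → z ≤ h × (∀ y → z ≤ y → y < h → residue y ∈ A) × residue h ∉ A
      extend : ∀ z → residue z ∈ A → Next (z + 1ℤ) → Next z
      extend z m (h , l , run , ¬m) = h , ℤ.≤-trans (ℤ.<⇒≤ (<+1 z)) l ,
        (λ y l l′ → [ (λ e → subst (λ x → residue x ∈ A) e m) , (λ z<y → run y z<y l′) ]′ (≤-split l)) , ¬m
      go : ∀ t {z} → Dec (residue z ∈ A) → residue (z + + t) ∉ A → Next z
      go t {z} (no ¬m) _ = z , ℤ.≤-refl , (λ y l l′ → contradiction l′ (ℤ.≤⇒≯ l)) , ¬m
      go 0 {z} (yes m) ¬m = contradiction (subst (λ x → residue x ∈ A) (sym (ℤ.+-identityʳ z)) m) ¬m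
      go (suc t) {z} (yes m) ¬m = extend z m
          (go t (residue (z + 1ℤ) ∈? A) (¬m ∘ subst (λ x → residue x ∈ A) (sym (+-1+ z (+ t)))))

    module _ (z : ℤ) (z∈A : residue z ∈ A)
             (h : ℤ) (z≤h : z ≤ h) (run : ∀ y → z ≤ y → y < h → residue y ∈ A) (h∉A : residue h ∉ A) where

      private
        z<h : z < h
        z<h = ℤ.≤∧≢⇒< z≤h λ e → h∉A (subst (λ x → residue x ∈ A) e z∈A)

        inversion-hole : Inversion f z h
        inversion-hole = z<h , run-end z h z<h run h∉A

        inversion⁺ : ∀ j → j ≢ h → Inversion f z j → Inversion g (z + 1ℤ) (u j)
        inversion⁺ j j≢h (z<j , lt) = z+1< , subst₂ _<_ (f≡ j) (trans (f≡ z) (cong g (up′ z z∈A))) lt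
          where
          z+1< : z + 1ℤ < u j
          z+1< with residue j ∈? A
          ... | yes m = subst (z + 1ℤ <_) (sym (up′ j m)) (ℤ.+-monoˡ-< 1ℤ z<j)
          ... | no ¬m with ℤ.<-cmp (z + 1ℤ) (u j)
          ...   | tri< l _ _ = l
          ...   | tri≈ _ e _ = contradiction (act-injective w (trans (up′ z z∈A) e)) (ℤ.<⇒≢ z<j)
          -- If `u j` were at most z, everything from z up to j would lie in A, and j would be the
          -- first position outside A.
          ...   | tri> _ _ l = contradiction
                    (run-unique z h j z≤h run h∉A (ℤ.<⇒≤ z<j)
                        (λ y z≤y → Down.between j ¬m y (ℤ.≤-trans (<+1⇒≤ l) z≤y)) ¬m) j≢h

        -- The position below `u h` is outside A while all of [z, h) is inside. So `u h` cannot lie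
        -- beyond z + 1, and h is never the preimage of an end of an inversion of g.
        ≢hole : ∀ y → Inversion g (z + 1ℤ) y → u⁻¹ y ≢ h
        ≢hole y (l , _) e = Down.start h h∉A (subst (λ x → residue (x - 1ℤ) ∈ A) (sym uh)
          (run (y - 1ℤ) (<+1⇒≤ (ℤ.<-trans (<+1 z) (subst (z + 1ℤ <_) (sym (-1+1 y)) l)))
              (ℤ.<-≤-trans (-1< y) (subst (_≤ h) uh (Down.≤z h h∉A)))))
          where
          uh : u h ≡ y
          uh = trans (cong u (sym e)) (act-reverseʳ w y)

      inversions-peel-hole : ∀ {n} → Fin n ↔ Inversions g (z + 1ℤ) → Fin (suc n) ↔ Inversions f z
      inversions-peel-hole {n} bij = mk↔ₛ′ to′ from′ to∘from from∘to
        where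
        module B = Inverse bij
        to′ : Fin (suc n) → Inversions f z
        to′ zero = h , inversion-hole
        to′ (suc i) = u⁻¹ (proj₁ (B.to i)) , inversion⁻ z _ z∈A (proj₂ (B.to i))
        from-dec : ∀ j → Dec (j ≡ h) → Inversion f z j → Fin (suc n)
        from-dec j (yes _) inv = zero
        from-dec j (no j≢h) inv = suc (B.from (u j , inversion⁺ j j≢h inv))
        from′ : Inversions f z → Fin (suc n)
        from′ (j , inv) = from-dec j (j ℤ.≟ h) inv
        to∘from : ∀ x → to′ (from′ x) ≡ x
        to∘from (j , inv) with j ℤ.≟ h
        ... | yes e = inversions-≡ (sym e)
        ... | no j≢h = inversions-≡ (trans
            (cong (u⁻¹ ∘ proj₁) (B.strictlyInverseˡ (u j , inversion⁺ j j≢h inv))) (act-reverseˡ w j))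
        from∘to : ∀ i → from′ (to′ i) ≡ i
        from∘to zero with h ℤ.≟ h
        ... | yes _ = refl
        ... | no h≢h = contradiction refl h≢h
        from∘to (suc i) with u⁻¹ (proj₁ (B.to i)) ℤ.≟ h
        ... | yes e = contradiction e (≢hole _ (proj₂ (B.to i)))
        ... | no j≢h = cong suc (trans (cong B.from (inversions-≡ (act-reverseʳ w _)))
            (B.strictlyInverseʳ i))

    inversions-peel : A ⊂ full → ∀ z → residue z ∈ A → ∀ {n} → Fin n ↔ Inversions g (z + 1ℤ) → Fin
        (suc n) ↔ Inversions f z
    inversions-peel (_ , b , _ , b∉A) z z∈A bij =
      -- The missing residue b occurs among z, ..., z + k, which makes the search for the first
      -- position outside A finite.
      let t , _ , e = residue-onto z b
          h , z≤h , run , h∉A = next-outside t z (b∉A ∘ subst (_∈ A) (sym e))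
      in inversions-peel-hole z z∈A h z≤h run h∉A bij

  -- The greedy decomposition

  data Canon : (ℤ → ℤ) → List (Subset (suc k)) → Set where
    done : ∀ {f} → (∀ z → ¬ Inversions f z) → Canon f []
    step : ∀ {f g A As w} → Spells A w → (∀ z → residue z ∈ A ⇔ Inversions f z) → Nonempty A × A ⊂ full →
           (∀ z → f z ≡ g (act w z)) → Canon g As → Canon f (A ∷ As)

  canon : ∀ D {f} → Affine f → Bounded f D → ∃ (Canon f)
  canon 0 aff bound = [] , done λ z (j , inv) → ℤ.<⇒≱ (proj₁ inv)
      (subst (j ≤_) (ℤ.+-identityʳ z) (bound z j inv))
  canon (suc D) {f} aff bound = go (Fin.any? dec)
    where
    dec : ∀ i → Dec (Inversions f (ι i))
    dec i = inversions? bound (ι i)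
    A : Subset (suc k)
    A = subset dec
    support : ∀ z → residue z ∈ A ⇔ Inversions f z
    support z = mk⇔
      (λ m → inversions-residue (periodicity aff) (ι (residue {k} z)) z (residue-ι (residue z))
          (⇒ (∈-subset dec (residue z)) m))
      (λ inv → ⇐ (∈-subset dec (residue z))
          (inversions-residue (periodicity aff) z (ι (residue {k} z)) (sym (residue-ι (residue z))) inv))
    proper : A ⊂ full
    proper = let z , none = inversion-free bound in (λ _ → ∈⊤) , residue z , ∈⊤ , λ m → none
        (⇒ (support z) m)
    go : Dec (∃ λ i → Inversions f (ι i)) → ∃ (Canon f)
    go (no none) = [] , done λ z inv → none
        (residue z , inversions-residue (periodicity aff) z (ι (residue {k} z))
        (sym (residue-ι (residue z))) inv)
    go (yes (i , inv)) =
      let w , spells = spelling A proper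
          f≡ : ∀ z → f z ≡ f (act (reverse w) (act w z))
          f≡ z = cong f (sym (act-reverseˡ w z))
          open Peel {f} {f ∘ act (reverse w)} aff spells support f≡
          As , c = canon D affine-peel (bounded-peel bound)
      in A ∷ As , step spells support ((i , ⇐ (∈-subset dec i) inv) , proper) f≡ c

  -- Without inversions f rises by at least 1 at every step. Over a period of k + 1 steps it rises
  -- by exactly k + 1, so every single step is exactly 1.
  translation : ∀ {f} → Affine f → (∀ z → ¬ Inversions f z) → ∀ z → f z ≡ z + f 0ℤ
  translation {f} aff none = λ { (+ n) → pos n ; -[1+ n ] → neg n }
    where
    mono : ∀ z → f z + 1ℤ ≤ f (z + 1ℤ)
    mono z = <⇒+1≤ (ℤ.≤∧≢⇒< (ℤ.≮⇒≥ λ lt → none z (z + 1ℤ , <+1 z , lt)) (ℤ.<⇒≢ (<+1 z) ∘ injectivity aff))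
    mono* : ∀ m z → f z + + m ≤ f (z + + m)
    mono* 0 z = ℤ.≤-reflexive (trans (ℤ.+-identityʳ (f z)) (cong f (sym (ℤ.+-identityʳ z))))
    mono* (suc m) z = ℤ.≤-trans (ℤ.≤-reflexive (+-1+ (f z) (+ m)))
      (ℤ.≤-trans (ℤ.+-monoˡ-≤ (+ m) (mono z))
          (ℤ.≤-trans (mono* m (z + 1ℤ)) (ℤ.≤-reflexive (cong f (sym (+-1+ z (+ m)))))))
    lem₁ : ∀ a m → a ≡ a + m + - m
    lem₁ = solve-∀
    one : ∀ z → f (z + 1ℤ) ≡ f z + 1ℤ
    one z = ℤ.≤-antisym (subst₂ _≤_ (sym (lem₁ (f (z + 1ℤ)) (+ k))) (sym (lem₁ (f z + 1ℤ) (+ k)))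
        (ℤ.+-monoˡ-≤ (- (+ k)) upper)) (mono z)
      where
      upper : f (z + 1ℤ) + + k ≤ f z + 1ℤ + + k
      upper = ℤ.≤-trans (mono* k (z + 1ℤ)) (ℤ.≤-reflexive (begin
        f (z + 1ℤ + + k)    ≡⟨ cong f (+-1+ z (+ k)) ⟨
        f (z + N)           ≡⟨ cong (λ y → f (z + y)) (ℤ.*-identityˡ N) ⟨
        f (z + 1ℤ * N)      ≡⟨ periodicity aff z 1ℤ ⟩
        f z + 1ℤ * N        ≡⟨ cong (λ y → f z + y) (ℤ.*-identityˡ N) ⟩
        f z + N             ≡⟨ +-1+ (f z) (+ k) ⟩
        f z + 1ℤ + + k      ∎))
        where open ≡-Reasoning
    pos : ∀ n → f (+ n) ≡ + n + f 0ℤ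
    pos 0 = sym (ℤ.+-identityˡ (f 0ℤ))
    pos (suc n) = trans (cong f (ℤ.+-comm 1ℤ (+ n)))
        (trans (one (+ n)) (trans (cong (_+ 1ℤ) (pos n)) (lem (+ n) (f 0ℤ))))
      where lem : ∀ a b → a + b + 1ℤ ≡ 1ℤ + a + b
            lem = solve-∀
    neg : ∀ n → f -[1+ n ] ≡ -[1+ n ] + f 0ℤ
    neg n = trans (lem (f -[1+ n ])) (trans (cong (_- 1ℤ) (trans (sym (one -[1+ n ])) (prev n))) (lem′ n))
      where
      lem : ∀ a → a ≡ a + 1ℤ - 1ℤ
      lem = solve-∀
      prev : ∀ n → f (-[1+ n ] + 1ℤ) ≡ -[1+ n ] + 1ℤ + f 0ℤ
      prev 0 = sym (ℤ.+-identityˡ (f 0ℤ))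
      prev (suc n) = neg n
      lem″ : ∀ a b → a + 1ℤ + b - 1ℤ ≡ a + b
      lem″ = solve-∀
      lem′ : ∀ n → -[1+ n ] + 1ℤ + f 0ℤ - 1ℤ ≡ -[1+ n ] + f 0ℤ
      lem′ n = lem″ -[1+ n ] (f 0ℤ)

  assemble : List (Word k) → Word k
  assemble = concat ∘ reverse

  assemble-∷ : ∀ w ws → assemble (w ∷ ws) ≡ assemble ws ++ w
  assemble-∷ w ws = trans (cong concat (List.unfold-reverse w ws))
      (trans (sym (List.concat-++ (reverse ws) (w ∷ [])))
    (cong (assemble ws ++_) (List.++-identityʳ w)))

  act-assemble-∷ : ∀ w ws z → act (assemble (w ∷ ws)) z ≡ act (assemble ws) (act w z)
  act-assemble-∷ w ws z = trans (cong (λ v → act v z) (assemble-∷ w ws)) (act-++ (assemble ws) w z)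

  -- The last quotient of the greedy process is a translation; `offset` is its amount, and validity
  -- of the assembled word is measured from that translation.
  record Factored (f : ℤ → ℤ) (As : List (Subset (suc k))) : Set where
    field
      proper  : All (λ A → Nonempty A × A ⊂ full) As
      words   : List (Word k)
      spelled : Pointwise Increasing As words
      offset  : ℤ
      valid   : Valid (_+ offset) (map gen (assemble words))
      acts    : ∀ z → f z ≡ act (assemble words) z + offset

  canon⇒factored : ∀ {f As} → Affine f → Canon f As → Factored f As
  canon⇒factored aff (done none) = record
    { proper = [] ; words = [] ; spelled = [] ; offset = _ ; valid = tt ; acts = translation aff none }
  canon⇒factored {f} aff (step {g = g} {w = w} spells support proper f≡ c) = record
    { proper = proper ∷ F.proper ; words = w ∷ F.words ; spelled = spells⇒increasing spells ∷ F.spelled ; offset = F.offset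
    ; valid = subst (Valid (_+ F.offset))
        (trans (sym (List.map-++ gen (assemble F.words) w)) (cong (map gen) (sym (assemble-∷ w F.words))))
        (Valid-++⁺ (map gen (assemble F.words)) (map gen w) F.valid
          (Valid-cong (map gen w) (λ z → trans (F.acts z)
              (cong (_+ F.offset) (sym (actᵍ-map (assemble F.words) z)))) P.valid))
    ; acts = λ z → trans (f≡ z) (trans (F.acts (act w z))
        (cong (_+ F.offset) (sym (act-assemble-∷ w F.words z)))) }
    where
    module P = Peel {f} {g} aff spells support f≡
    module F = Factored (canon⇒factored P.affine-peel c)

  -- The code as a recursion on the list of subsets

  private variable
    X Y : Set

  length-filter-∷ : ∀ {P : X → Set} (P? : ∀ x → Dec (P x)) x xs →
    length (filter P? (x ∷ xs)) ≡ (if does (P? x) then suc else id) (length (filter P? xs))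
  length-filter-∷ P? x xs with does (P? x)
  ... | false = refl
  ... | true  = refl

  length-filter-tabulate : ∀ {n} {P : X → Set} {Q : Y → Set} (P? : ∀ x → Dec (P x)) (Q? : ∀ y → Dec (Q y))
    (f : Fin n → X) (g : Fin n → Y) → (∀ j → does (P? (f j)) ≡ does (Q? (g j))) →
    length (filter P? (tabulateˡ f)) ≡ length (filter Q? (tabulateˡ g))
  length-filter-tabulate {n = 0} P? Q? f g e = refl
  length-filter-tabulate {n = suc n} P? Q? f g e = begin
    length (filter P? (tabulateˡ f))
      ≡⟨ length-filter-∷ P? (f zero) _ ⟩
    (if does (P? (f zero)) then suc else id) (length (filter P? (tabulateˡ (f ∘ suc))))
      ≡⟨ cong₂ (λ b → if b then suc else id) (e zero)
           (length-filter-tabulate P? Q? (f ∘ suc) (g ∘ suc) (e ∘ suc)) ⟩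
    (if does (Q? (g zero)) then suc else id) (length (filter Q? (tabulateˡ (g ∘ suc))))
      ≡⟨ length-filter-∷ Q? (g zero) _ ⟨
    length (filter Q? (tabulateˡ g)) ∎
    where open ≡-Reasoning

  -- Dropping the first subset lowers each index by one, and this is absorbed into the residue as a
  -- shift by ε. With ε = 1 it matches the passage from inversions at z to those of the quotient at
  -- z + 1.
  shiftedCount-∷ : ∀ ε A As (i : I k) →
    shiftedCount ε (A ∷ As) i ≡ (if does (i ∈? A) then suc else id) (shiftedCount ε As (i ⊕ ε))
  shiftedCount-∷ ε A As i = begin
    shiftedCount ε (A ∷ As) i
      ≡⟨ length-filter-∷ P? zero _ ⟩
    (if does (P? zero) then suc else id) (length (filter P? (tabulateˡ suc)))
      ≡⟨ cong₂ (λ j → if does (j ∈? A) then suc else id) (trans (cong (i ⊕_) (ℤ.*-zeroʳ ε)) (⊕-0 i))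
           (length-filter-tabulate P? Q? suc id λ j → cong (λ i → does (i ∈? lookup As j))
             (trans (cong (i ⊕_) (lem ε (+ toℕ j))) (sym (⊕-⊕ i ε (ε * + toℕ j))))) ⟩
    (if does (i ∈? A) then suc else id) (shiftedCount ε As (i ⊕ ε)) ∎
    where
    open ≡-Reasoning
    P? : ∀ j → Dec (i ⊕ ε * + toℕ j ∈ lookup (A ∷ As) j)
    P? j = i ⊕ ε * + toℕ j ∈? lookup (A ∷ As) j
    Q? : ∀ j → Dec (i ⊕ ε ⊕ ε * + toℕ j ∈ lookup As j)
    Q? j = i ⊕ ε ⊕ ε * + toℕ j ∈? lookup As j
    lem : ∀ e j → e * (1ℤ + j) ≡ e + e * j
    lem = solve-∀

  ↔-empty : ¬ X → ¬ Y → X ↔ Y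
  ↔-empty ¬x ¬y = mk↔ₛ′ (⊥-elim ∘ ¬x) (⊥-elim ∘ ¬y) (⊥-elim ∘ ¬y) (⊥-elim ∘ ¬x)

  canon-code : ∀ {f As} → Affine f → Canon f As → ∀ z → Fin (RI As (residue z)) ↔ Inversions f z
  canon-code aff (done none) z = ↔-empty (λ ()) (none z)
  canon-code aff (step {f} {g} {A} {As} spells support (_ , proper) f≡ c) z =
    subst (λ n → Fin n ↔ Inversions f z) (sym (shiftedCount-∷ 1ℤ A As (residue z))) (go (residue z ∈? A))
    where
    module P = Peel {f} {g} aff spells support f≡
    n = RI As (residue z ⊕ 1ℤ)
    ih : Fin n ↔ Inversions g (z + 1ℤ)
    ih = subst (λ i → Fin (RI As i) ↔ Inversions g (z + 1ℤ)) (sym (residue-⊕ z 1ℤ))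
        (canon-code P.affine-peel c (z + 1ℤ))
    go : (d : Dec (residue z ∈ A)) → Fin ((if does d then suc else id) n) ↔ Inversions f z
    go (yes m) = P.inversions-peel proper z m ih
    go (no ¬m) = ↔-empty (P.inversion-free-peel z ¬m ∘ Inverse.to ih) (¬m ∘ ⇐ (support z))

  -- Lexicographic maximality and uniqueness of the greedy list

  infix 4 _≼_

  _≼_ : List (Subset (suc k)) → List (Subset (suc k)) → Set
  As ≼ Bs = Lex-≤ _≡_ ℕ._<_ (map card As) (map card Bs)

  ⊆⇒≡⊎< : ∀ {A B : Subset (suc k)} → A ⊆ˢ B → A ≡ B ⊎ card A ℕ.< card B
  ⊆⇒≡⊎< {A} {B} A⊆B with Fin.any? (λ i → (i ∈? B) ×-dec ¬? (i ∈? A))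
  ... | yes (i , i∈B , i∉A) = inj₂ (p⊂q⇒∣p∣<∣q∣ (A⊆B , i , i∈B , i∉A))
  ... | no none = inj₁ (⊆-antisym A⊆B λ {i} m → case i ∈? A of
      λ { (yes m′) → m′ ; (no ¬m) → contradiction (i , m , ¬m) none })

  -- The letters of the rival's first factor B start inversions, so B is contained in A. If the
  -- inclusion is strict, the cardinalities decide. If B = A, `act-unique` makes both quotients
  -- equal and the comparison continues there. An exhausted greedy list leaves no inversion for a
  -- nonempty B.
  canon-maximal : ∀ {f x As Bs ws} → Affine f → Canon f As →
    All Nonempty Bs → Pointwise Increasing Bs ws → Valid x (map gen (assemble ws)) →
        (∀ z → f z ≡ x (act (assemble ws) z)) →
    Bs ≼ As × (As ≼ Bs → As ≡ Bs)
  canon-maximal {As = []} aff c [] [] v e = base tt , λ _ → refl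
  canon-maximal {As = A ∷ As} aff c [] [] v e = halt , λ ()
  canon-maximal {f} {x} {As} {B ∷ Bs} {w ∷ ws} aff c ((b , b∈B) ∷ ne) (inc ∷ incs) v e
    with v₁ , v₂ ← Valid-++⁻ (map gen (assemble ws)) (map gen w)
           (subst (Valid x) (trans (cong (map gen) (assemble-∷ w ws)) (List.map-++ gen (assemble ws) w)) v)
    = go c
    where
    module S = Spells (increasing⇒spells inc)
    e′ : ∀ z → f z ≡ x (act (assemble ws) (act w z))
    e′ z = trans (e z) (cong x (act-assemble-∷ w ws z))
    v₂′ : Valid (x ∘ act (assemble ws)) (map gen w)
    v₂′ = Valid-cong (map gen w) (λ z → cong x (actᵍ-map (assemble ws) z)) v₂
    inversions : ∀ i → i ∈ B → Inversions f (ι i)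
    inversions i m = valid⇒inversion S.ordered e′ v₂′ (ι i)
        (⇐ (S.letters _) (subst (_∈ B) (sym (residue-ι i)) m))
    go : ∀ {As} → Canon f As → (B ∷ Bs) ≼ As × (As ≼ (B ∷ Bs) → As ≡ B ∷ Bs)
    go (done none) = contradiction (inversions b b∈B) (none (ι b))
    go (step {g = g} {A} {As} {u} spells support _ f≡ c) with ⊆⇒≡⊎< {B} {A}
        (λ {i} m → subst (_∈ A) (residue-ι i) (⇐ (support (ι i)) (inversions i m)))
    ... | inj₂ lt = this lt , λ { (this lt′) → contradiction lt (ℕ.<-asym lt′) ; (next eq _) →
        contradiction (sym eq) (ℕ.<⇒≢ lt) }
    ... | inj₁ refl = next refl (proj₁ rest) ,
      λ { (this lt) → contradiction lt (ℕ.<-irrefl refl) ; (next _ le) → cong (A ∷_) (proj₂ rest le) }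
      where
      g≡ : ∀ z → g z ≡ x (act (assemble ws) z)
      g≡ z = begin
        g z                                              ≡⟨ cong g (act-reverseʳ u z) ⟨
        g (act u (act (reverse u) z))                    ≡⟨ f≡ (act (reverse u) z) ⟨
        f (act (reverse u) z)                            ≡⟨ e′ (act (reverse u) z) ⟩
        x (act (assemble ws) (act w (act (reverse u) z)))
          ≡⟨ cong (x ∘ act (assemble ws)) (act-unique S.ordered (Spells.ordered spells)
               (λ i → mk⇔ (⇐ (Spells.letters spells i) ∘ ⇒ (S.letters i))
                   (⇐ (S.letters i) ∘ ⇒ (Spells.letters spells i))) _) ⟩
        x (act (assemble ws) (act u (act (reverse u) z))) ≡⟨ cong (x ∘ act (assemble ws))
            (act-reverseʳ u z) ⟩
        x (act (assemble ws) z)                          ∎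
        where open ≡-Reasoning
      rest : Bs ≼ As × (As ≼ Bs → As ≡ Bs)
      rest = canon-maximal {g} {x} (Peel.affine-peel {f} {g} aff spells support f≡) c ne incs v₁ g≡

  -- Normalisation

  window : ℕ → (ℤ → ℤ) → ℤ → ℤ
  window n f m = sum {n} (λ j → f (m + + toℕ j))

  window-cong : ∀ n {f g} → (∀ z → f z ≡ g z) → ∀ m → window n f m ≡ window n g m
  window-cong n e m = sum-cong-≗ {n} (λ j → e (m + + toℕ j))

  window-suc : ∀ n f m → window (suc n) f m ≡ f m + window n f (m + 1ℤ)
  window-suc n f m = cong₂ _+_ (cong f (ℤ.+-identityʳ m)) (sum-cong-≗ {n} λ j → cong f (+-1+ m (+ toℕ j)))

  window-last : ∀ n f m → window (suc n) f m ≡ window n f m + f (m + + n)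
  window-last n f m = trans (sum-init-last {n} (λ j → f (m + + toℕ j)))
    (cong₂ _+_ (sum-cong-≗ {n} λ j → cong (λ i → f (m + + i)) (Fin.toℕ-inject₁ j))
        (cong (λ i → f (m + + i)) (Fin.toℕ-fromℕ n)))

  period : ∀ {f} → Periodic f → ∀ z → f (z + N) ≡ f z + N
  period {f} p z = subst (λ n → f (z + n) ≡ f z + n) (ℤ.*-identityˡ N) (p z 1ℤ)

  -- Sliding by one place exchanges the term f m for f (m + N), which is larger by N.
  window-+1 : ∀ {f} → Periodic f → ∀ m → window (suc k) f (m + 1ℤ) ≡ window (suc k) f m + N
  window-+1 {f} p m = begin
    window (suc k) f (m + 1ℤ)                   ≡⟨ window-last k f (m + 1ℤ) ⟩
    window k f (m + 1ℤ) + f (m + 1ℤ + + k)      ≡⟨ cong (λ y → window k f (m + 1ℤ) + f y) (+-1+ m (+ k)) ⟨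
    window k f (m + 1ℤ) + f (m + N)             ≡⟨ cong (λ y → window k f (m + 1ℤ) + y) (period {f} p m) ⟩
    window k f (m + 1ℤ) + (f m + N)             ≡⟨ lem (window k f (m + 1ℤ)) (f m) N ⟩
    f m + window k f (m + 1ℤ) + N               ≡⟨ cong (_+ N) (window-suc k f m) ⟨
    window (suc k) f m + N                      ∎
    where
    open ≡-Reasoning
    lem : ∀ a b c → a + (b + c) ≡ b + a + c
    lem = solve-∀

  window-+ : ∀ {f} → Periodic f → ∀ n m → window (suc k) f (m + + n) ≡ window (suc k) f m + + n * N
  window-+ {f} p 0 m = trans (cong (window (suc k) f) (ℤ.+-identityʳ m))
      (sym (ℤ.+-identityʳ (window (suc k) f m)))
  window-+ {f} p (suc n) m = begin
    window (suc k) f (m + + suc n)              ≡⟨ cong (window (suc k) f) (+-1+ m (+ n)) ⟩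
    window (suc k) f (m + 1ℤ + + n)             ≡⟨ window-+ {f} p n (m + 1ℤ) ⟩
    window (suc k) f (m + 1ℤ) + + n * N         ≡⟨ cong (_+ + n * N) (window-+1 {f} p m) ⟩
    window (suc k) f m + N + + n * N            ≡⟨ lem (window (suc k) f m) (+ n) N ⟩
    window (suc k) f m + + suc n * N            ∎
    where
    open ≡-Reasoning
    lem : ∀ a b c → a + c + b * c ≡ a + (1ℤ + b) * c
    lem = solve-∀

  -- A window starting at a position ≡ i contains both positions exchanged by s i.
  window-s : ∀ f (i : I k) m → residue m ≡ i → window (suc k) (f ∘ s i) m ≡ window (suc k) f m
  window-s f i m r = go k refl 1≤k
    where
    fixed : ∀ d → suc (suc d) ℕ.< suc k → s i (m + 1ℤ + 1ℤ + + d) ≡ m + 1ℤ + 1ℤ + + d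
    fixed d d<k = s-fix _
      (λ e → residue-+-≢ m (suc (suc d)) (ℕ.s≤s ℕ.z≤n) d<k
          (trans (cong residue (lem m (+ d))) (trans e (sym r))))
      (λ e → residue-+-≢ m (suc d) (ℕ.s≤s ℕ.z≤n) (ℕ.<-trans (ℕ.n<1+n (suc d)) d<k)
          (trans (cong residue (lem′ m (+ d))) (trans e (sym r))))
      where
      lem : ∀ m d → m + (1ℤ + (1ℤ + d)) ≡ m + 1ℤ + 1ℤ + d
      lem = solve-∀
      lem′ : ∀ m d → m + (1ℤ + d) ≡ m + 1ℤ + 1ℤ + d - 1ℤ
      lem′ = solve-∀
    go : ∀ n → n ≡ k → 1 ℕ.≤ n → window (suc n) (f ∘ s i) m ≡ window (suc n) f m
    go (suc n) n≡k _ = begin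
      window (suc (suc n)) (f ∘ s i) m
        ≡⟨ trans (window-suc (suc n) (f ∘ s i) m)
             (cong (λ y → f (s i m) + y) (window-suc n (f ∘ s i) (m + 1ℤ))) ⟩
      f (s i m) + (f (s i (m + 1ℤ)) + window n (f ∘ s i) (m + 1ℤ + 1ℤ))
        ≡⟨ cong₂ (λ a b → f a + (f b + window n (f ∘ s i) (m + 1ℤ + 1ℤ))) (s-up m r) (s-down m r) ⟩
      f (m + 1ℤ) + (f m + window n (f ∘ s i) (m + 1ℤ + 1ℤ))
        ≡⟨ cong (λ y → f (m + 1ℤ) + (f m + y))
             (sum-cong-≗ {n} λ j → cong f (fixed (toℕ j)
             (ℕ.s≤s (subst (suc (toℕ j) ℕ.<_) n≡k (ℕ.s≤s (Fin.toℕ<n j)))))) ⟩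
      f (m + 1ℤ) + (f m + window n f (m + 1ℤ + 1ℤ))
        ≡⟨ lem (f (m + 1ℤ)) (f m) (window n f (m + 1ℤ + 1ℤ)) ⟩
      f m + (f (m + 1ℤ) + window n f (m + 1ℤ + 1ℤ))
        ≡⟨ trans (window-suc (suc n) f m) (cong (λ y → f m + y) (window-suc n f (m + 1ℤ))) ⟨
      window (suc (suc n)) f m ∎
      where
      open ≡-Reasoning
      lem : ∀ a b c → a + (b + c) ≡ b + (a + c)
      lem = solve-∀

  periodic-∘ : ∀ {f g} → Periodic f → Periodic g → Periodic (f ∘ g)
  periodic-∘ {f} {g} p p′ z q = trans (cong f (p′ z q)) (p (g z) q)

  total : (ℤ → ℤ) → ℤ
  total f = window (suc k) f 1ℤ

  -- A window may cut a pair exchanged by `s i`. Sliding it by n changes both sums by n * N and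
  -- brings its start to a position where the pair is whole.
  total-s : ∀ {f} → Periodic f → ∀ i → total (f ∘ s i) ≡ total f
  total-s {f} p i = ∙-cancelʳ (+ n * N) _ _ (begin
    total (f ∘ s i) + + n * N            ≡⟨ window-+ {f ∘ s i}
        (periodic-∘ {f} {s i} p (s-periodic i)) n 1ℤ ⟨
    window (suc k) (f ∘ s i) (1ℤ + + n)  ≡⟨ window-s f i (1ℤ + + n) r ⟩
    window (suc k) f (1ℤ + + n)          ≡⟨ window-+ {f} p n 1ℤ ⟩
    total f + + n * N                    ∎)
    where
    open ≡-Reasoning
    -- The slid window starts at 1 + n = i + (k + 1), which is congruent to i.
    n = toℕ i ℕ.+ k
    lem : ∀ i k → 1ℤ + (i + k) ≡ i + 1ℤ * (1ℤ + k)
    lem = solve-∀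
    r : residue (1ℤ + + n) ≡ i
    r = trans (cong residue (lem (ι i) (+ k))) (trans (residue-shift (ι i) 1ℤ) (residue-ι i))

  total-act : ∀ {f} → Periodic f → ∀ (w : Word k) → total (f ∘ act w) ≡ total f
  total-act {f} p []      = refl
  total-act {f} p (i ∷ w) = trans (total-act {f ∘ s i} (periodic-∘ {f} {s i} p (s-periodic i)) w)
      (total-s {f} p i)

  total-+ : ∀ t → total (_+ t) ≡ total id + t * N
  total-+ t = trans (∑-distrib-+ {suc k} (λ j → 1ℤ + + toℕ j) (const t))
      (cong (λ y → total id + y) (const-sum (suc k)))
    where
    lem : ∀ t n → t + t * n ≡ t * (1ℤ + n)
    lem = solve-∀
    const-sum : ∀ n → sum {n} (const t) ≡ t * + n
    const-sum 0       = sym (ℤ.*-zeroʳ t)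
    const-sum (suc n) = trans (cong (λ y → t + y) (const-sum n)) (lem t (+ n))

  total-id : total id ≡ + ((2 ℕ.+ k) C 2)
  total-id = go (suc k)
    where
    go : ∀ n → window n id 1ℤ ≡ + (suc n C 2)
    go 0 = refl
    go (suc n) = trans (window-last n id 1ℤ) (trans (cong (_+ + suc n) (go n))
      (cong +_ (trans (ℕ.+-comm (suc n C 2) (suc n))
          (trans (cong (ℕ._+ suc n C 2) (sym (nC1≡n (suc n)))) (nCk+nC[k+1]≡[n+1]C[k+1] (suc n) 1)))))

  record Normal (f : ℤ → ℤ) : Set where
    field
      isAffine : Affine f
      isNormal : total f ≡ total id

  normal-act : ∀ {f} (w : Word k) → (∀ z → act w z ≡ f z) → Normal f
  normal-act {f} w e = record
    { isAffine = affine (λ z q → trans (sym (e (z + q * N)))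
        (trans (act-periodic w z q) (cong (_+ q * N) (e z))))
                        (λ {y} {z} e′ → act-injective w (trans (e y) (trans e′ (sym (e z)))))
    ; isNormal = trans (window-cong (suc k) (sym ∘ e) 1ℤ) (total-act {id} (λ _ _ → refl) w) }

  -- `act w` preserves the total while a translation by t raises it by t * N, so equal totals leave
  -- only t = 0.
  normal-offset : ∀ {f w t} → Normal f → (∀ z → f z ≡ act {k} w z + t) → t ≡ 0ℤ
  normal-offset {f} {w} {t} nf e = ℤ.*-cancelʳ-≡ t 0ℤ N (∙-cancelˡ (total id) _ _ (begin
    total id + t * N        ≡⟨ total-+ t ⟨
    total (_+ t)            ≡⟨ total-act {_+ t} (λ z q → +-swap z (q * N) t) w ⟨
    total ((_+ t) ∘ act w)  ≡⟨ window-cong (suc k) e 1ℤ ⟨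
    total f                 ≡⟨ Normal.isNormal nf ⟩
    total id                ≡⟨ ℤ.+-identityʳ (total id) ⟨
    total id + 0ℤ * N       ∎))
    where open ≡-Reasoning

  -- A periodic map displaces every point by at most some M. An inversion then has j - M ≤ f j < f z
  -- ≤ z + M, whence the bound 2M.
  bounded : ∀ {f} → Affine f → ∃ (Bounded f)
  bounded {f} aff = M ℕ.+ M , λ z j (z<j , lt) → subst (j ≤_) (ℤ.+-assoc z (+ M) (+ M))
    (subst (_≤ z + + M + + M) (lem j (+ M))
        (ℤ.+-monoˡ-≤ (+ M) (ℤ.≤-trans (lower j) (ℤ.≤-trans (ℤ.<⇒≤ lt) (upper z)))))
    where
    lem : ∀ a b → a - b + b ≡ a
    lem = solve-∀
    -- Any upper bound serves, so the sum of the values is taken.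
    max : ∀ {n} (h : Fin n → ℕ) → ∃ λ m → ∀ i → h i ℕ.≤ m
    max {0} h = 0 , λ ()
    max {suc n} h with m , le ← max (h ∘ suc) = h zero ℕ.+ m ,
      λ { zero → ℕ.m≤m+n (h zero) m ; (suc i) → ℕ.≤-trans (le i) (ℕ.m≤n+m m (h zero)) }
    displacement = max {suc k} (λ i → ∣ f (ι i) - ι i ∣)
    M = proj₁ displacement
    near : ∀ z → ∣ f z - z ∣ ℕ.≤ M
    near z = subst (λ d → ∣ d ∣ ℕ.≤ M)
        (displacement-residue {f} (periodicity aff) (ι (residue {k} z)) z (residue-ι (residue z)))
        (proj₂ displacement (residue z))
    i≤∣i∣ : ∀ i → i ≤ + ∣ i ∣
    i≤∣i∣ (+ n) = ℤ.≤-refl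
    i≤∣i∣ -[1+ n ] = _≤_.-≤+
    lem₁ : ∀ a b → b + (a - b) ≡ a
    lem₁ = solve-∀
    upper : ∀ z → f z ≤ z + + M
    upper z = subst (_≤ z + + M) (lem₁ (f z) z) (ℤ.+-monoʳ-≤ z (ℤ.≤-trans (i≤∣i∣ (f z - z)) (+≤+ (near z))))
    lem₂ : ∀ a b m → a + (b - a) - m ≡ b - m
    lem₂ = solve-∀
    lem₃ : ∀ a m → a + m - m ≡ a
    lem₃ = solve-∀
    lower : ∀ z → z - + M ≤ f z
    lower z = subst₂ _≤_ (lem₂ (f z) z (+ M)) (lem₃ (f z) (+ M)) (ℤ.+-monoˡ-≤ (- (+ M)) (ℤ.+-monoʳ-≤ (f z)
      (ℤ.≤-trans (i≤∣i∣ (z - f z)) (+≤+ (subst (ℕ._≤ M) (ℤ.∣i-j∣≡∣j-i∣ (f z) z) (near z))))))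

  -- The increasing right decomposition of a normalised map

  record Factors (Spelling : Subset (suc k) → Word k → Set) (asm : List (Word k) → Word k)
                 (f : ℤ → ℤ) (As : List (Subset (suc k))) : Set where
    field
      proper  : All (λ A → Nonempty A × A ⊂ full) As
      words   : List (Word k)
      spelled : Pointwise Spelling As words
      reduced : Reduced (asm words)
      acts    : ∀ z → act (asm words) z ≡ f z

  Greatest : (List (Subset (suc k)) → Set) → List (Subset (suc k)) → Set
  Greatest D As = D As × (∀ Bs → D Bs → Bs ≼ As)

  increasing-factors : ∀ {f} → Normal f →
    The (Greatest (Factors Increasing assemble f)) (λ As → ∀ z → Fin (RI As (residue z)) ↔ Inversions f z)
  increasing-factors {f} nf =
    (As , (factors , λ Bs F → proj₁ (maximal Bs F)) , λ {Bs} (F , great) → proj₂ (maximal Bs F)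
        (great As factors)) ,
    canon-code aff c
    where
    aff = Normal.isAffine nf
    As = proj₁ (canon _ aff (proj₂ (bounded aff)))
    c : Canon f As
    c = proj₂ (canon _ aff (proj₂ (bounded aff)))
    module F = Factored (canon⇒factored aff c)
    offset≡0 : F.offset ≡ 0ℤ
    offset≡0 = normal-offset {w = assemble F.words} nf F.acts
    +offset : ∀ z → z + F.offset ≡ z
    +offset z = trans (cong (λ t → z + t) offset≡0) (ℤ.+-identityʳ z)
    factors : Factors Increasing assemble f As
    factors = record
      { proper = F.proper ; words = F.words ; spelled = F.spelled
      ; reduced = valid⇒reduced (assemble F.words) (Valid-cong (map gen (assemble F.words)) +offset F.valid)
      ; acts = λ z → sym (trans (F.acts z) (+offset _)) }
    maximal : ∀ Bs → Factors Increasing assemble f Bs → Bs ≼ As × (As ≼ Bs → As ≡ Bs)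
    maximal Bs F = canon-maximal {x = id} aff c (All.map proj₁ G.proper) G.spelled
        (reduced⇒valid (assemble G.words) G.reduced) (sym ∘ G.acts)
      where module G = Factors F

  -- Symmetries

  -- Decompositions are compared through their cardinalities alone. An involution preserving these
  -- and exchanging the two kinds of decomposition therefore carries over both the greatest one and
  -- its uniqueness.
  transfer : ∀ {D D′ Q Q′ : List (Subset (suc k)) → Set}
      (σ : List (Subset (suc k)) → List (Subset (suc k))) →
    (∀ As → σ (σ As) ≡ As) → (∀ As → map card (σ As) ≡ map card As) →
    (∀ {As} → D′ As → D (σ As)) → (∀ {As} → D As → D′ (σ As)) → (∀ {As} → Q As → Q′ (σ As)) →
    The (Greatest D) Q → The (Greatest D′) Q′
  transfer {D} {D′} σ σσ cards f g h ((As , (d , great) , unique) , q) =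
    (σ As , (g d , λ Bs d′ → subst₂ (Lex-≤ _≡_ ℕ._<_) (cards Bs) (sym (cards As)) (great (σ Bs) (f d′))) ,
     λ {Bs} (d′ , great′) → trans (cong σ (unique (f d′ , λ Cs c →
       subst₂ (Lex-≤ _≡_ ℕ._<_) (cards Cs) (sym (cards Bs)) (great′ (σ Cs) (g c))))) (σσ Bs)) , h q

  -- `Factors` speaks of a bare map, so that inverses and reflections of x can be factored without
  -- first being made into affine permutations.
  decomposition⇒factors : ∀ {Sp asm x As} → Decomposition Sp asm x As → Factors Sp asm (to x) As
  decomposition⇒factors {x = x} d = record
    { proper = D.proper ; words = D.words ; spelled = D.spelled
    ; reduced = proj₁ (represents⁻ {x = x} D.product) ; acts = proj₂ (represents⁻ {x = x} D.product) }
    where module D = Decomposition d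

  factors⇒decomposition : ∀ {Sp asm x As} → Factors Sp asm (to x) As → Decomposition Sp asm x As
  factors⇒decomposition {x = x} d = record
    { proper = D.proper ; words = D.words ; spelled = D.spelled ; product = represents⁺ {x = x} D.reduced D.acts }
    where module D = Factors d

  reduced-reverse : ∀ (w : Word k) → Reduced w → Reduced (reverse w)
  reduced-reverse w red v e = subst₂ ℕ._≤_ (sym (List.length-reverse w)) (List.length-reverse v)
    (red (reverse v) λ z → begin
      act (reverse v) z                              ≡⟨ cong (act (reverse v)) (act-reverseˡ w z) ⟨
      act (reverse v) (act (reverse w) (act w z))    ≡⟨ cong (act (reverse v)) (e (act w z)) ⟨
      act (reverse v) (act v (act w z))              ≡⟨ act-reverseˡ v (act w z) ⟩
      act w z                                        ∎)
    where open ≡-Reasoning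

  eachOnce-reverse : ∀ {A} {w : Word k} → EachOnce A w → EachOnce A (reverse w)
  eachOnce-reverse {A} {w} once = record
    { unique = Permutation.Unique-resp-↭ (setoid (I k)) (↭⇒↭ₛ (↭-sym (↭-reverse w))) O.unique
    ; letters = λ i → mk⇔ (⇒ (O.letters i) ∘ Any.reverse⁻) (Any.reverse⁺ ∘ ⇐ (O.letters i)) }
    where module O = EachOnce once

  decreasing-reverse : ∀ {A} {w : Word k} → Decreasing A w → Increasing A (reverse w)
  decreasing-reverse (once , sub) = eachOnce-reverse once , λ j m m′ → Sublist.reverse⁺ (sub j m m′)

  increasing-reverse : ∀ {A} {w : Word k} → Increasing A w → Decreasing A (reverse w)
  increasing-reverse (once , sub) = eachOnce-reverse once , λ j m m′ → Sublist.reverse⁺ (sub j m m′)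

  concat-map-reverse : (ws : List (Word k)) → concat (map reverse ws) ≡ reverse (assemble ws)
  concat-map-reverse []       = refl
  concat-map-reverse (w ∷ ws) = trans (cong (reverse w ++_) (concat-map-reverse ws))
    (trans (sym (List.reverse-++ (assemble ws) w)) (cong reverse (sym (assemble-∷ w ws))))

  assemble-map-reverse : (ws : List (Word k)) → assemble (map reverse ws) ≡ reverse (concat ws)
  assemble-map-reverse []       = refl
  assemble-map-reverse (w ∷ ws) = trans (assemble-∷ (reverse w) (map reverse ws))
    (trans (cong (_++ reverse w) (assemble-map-reverse ws)) (sym (List.reverse-++ w (concat ws))))

  factors-reverse : ∀ {Sp Sp′ : Subset (suc k) → Word k → Set} {asm asm′ : List (Word k) →
      Word k} {f f⁻¹ As} →
    (∀ {A w} → Sp A w → Sp′ A (reverse w)) → (∀ ws → asm′ (map reverse ws) ≡ reverse (asm ws)) →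
    (∀ z → f⁻¹ (f z) ≡ z) → (∀ z → f (f⁻¹ z) ≡ z) → Factors Sp asm f As → Factors Sp′ asm′ f⁻¹ As
  factors-reverse {Sp′ = Sp′} {asm} {asm′} {f} {f⁻¹} sp assembled invˡ invʳ d = record
    { proper = D.proper ; words = map reverse D.words ; spelled = go D.spelled
    ; reduced = subst Reduced (sym (assembled D.words)) (reduced-reverse (asm D.words) D.reduced)
    ; acts = λ z → begin
        act (asm′ (map reverse D.words)) z                  ≡⟨ cong (λ w → act w z) (assembled D.words) ⟩
        act (reverse W) z                                   ≡⟨ cong (act (reverse W)) (invʳ z) ⟨
        act (reverse W) (f (f⁻¹ z))                         ≡⟨ cong (act (reverse W)) (D.acts (f⁻¹ z)) ⟨
        act (reverse W) (act W (f⁻¹ z))                     ≡⟨ act-reverseˡ W (f⁻¹ z) ⟩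
        f⁻¹ z                                               ∎ }
    where
    open ≡-Reasoning
    module D = Factors d
    W = asm D.words
    go : ∀ {As ws} → Pointwise _ As ws → Pointwise Sp′ As (map reverse ws)
    go []       = []
    go (p ∷ ps) = sp p ∷ go ps

  -- Negating letters and reflecting maps

  neg : I k → I k
  neg i = residue (- ι i)

  residue-neg : ∀ y z → residue {k} y ≡ residue z → residue {k} (- y) ≡ residue (- z)
  residue-neg y z e with q , refl ← residue-≡⇒ y z e = trans (cong residue (lem z q N))
      (residue-shift (- z) (- q))
    where lem : ∀ z q n → - (z + q * n) ≡ - z + - q * n
          lem = solve-∀

  neg-residue : ∀ z → neg (residue z) ≡ residue (- z)
  neg-residue z = residue-neg (ι (residue {k} z)) z (residue-ι (residue z))

  neg-involutive : ∀ i → neg (neg i) ≡ i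
  neg-involutive i = trans (neg-residue (- ι i))
      (trans (cong residue (ℤ.neg-involutive (ι i))) (residue-ι i))

  neg-⊕ : ∀ i m → neg (i ⊕ m) ≡ neg i ⊕ - m
  neg-⊕ i m = trans (neg-residue (ι i + m))
      (trans (cong residue (ℤ.neg-distrib-+ (ι i) m)) (sym (residue-⊕ (- ι i) (- m))))

  -- The centre is 1/2 so that the pair {i, i + 1} goes to {1 - i, -i}, the pair exchanged by the
  -- negated letter; a reflection about 0 would give the letter -i - 1.
  reflect : (ℤ → ℤ) → ℤ → ℤ
  reflect f z = 1ℤ - f (1ℤ - z)

  1-1- : ∀ z → 1ℤ - (1ℤ - z) ≡ z
  1-1- = solve-∀

  s-neg : ∀ i z → s (neg i) z ≡ reflect (s i) z
  s-neg i z = go (1ℤ - z) (sym (1-1- z))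
    where
    go : ∀ y {z} → z ≡ 1ℤ - y → s (neg i) z ≡ 1ℤ - s i y
    go y refl with moves i y
    ... | up {y} p e = trans (cong (s (neg i)) (lem₁ y))
        (trans (s-down (- y) (trans (sym (neg-residue y)) (cong neg p)))
        (trans (lem₂ y) (cong (λ x → 1ℤ - x) (sym e))))
      where
      lem₁ : ∀ y → 1ℤ - y ≡ - y + 1ℤ
      lem₁ = solve-∀
      lem₂ : ∀ y → - y ≡ 1ℤ - (y + 1ℤ)
      lem₂ = solve-∀
    ... | down {y} p e = trans (s-up (1ℤ - (y + 1ℤ))
        (trans (cong residue (lem₁ y)) (trans (sym (neg-residue y)) (cong neg p))))
            (trans (lem₂ y) (cong (λ x → 1ℤ - x) (sym e)))
      where
      lem₁ : ∀ y → 1ℤ - (y + 1ℤ) ≡ - y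
      lem₁ = solve-∀
      lem₂ : ∀ y → 1ℤ - (y + 1ℤ) + 1ℤ ≡ 1ℤ - y
      lem₂ = solve-∀
    ... | fix {y} p q e = trans (s-fix (1ℤ - y) (q ∘ back (1ℤ - y) (y - 1ℤ) (lem₁ y))
        (p ∘ back (1ℤ - y - 1ℤ) y (lem₂ y))) (cong (λ x → 1ℤ - x) (sym e))
      where
      back : ∀ x y → - x ≡ y → residue x ≡ neg i → residue y ≡ i
      back x y e r = trans (cong residue (sym e))
          (trans (sym (neg-residue x)) (trans (cong neg r) (neg-involutive i)))
      lem₁ : ∀ y → - (1ℤ - y) ≡ y - 1ℤ
      lem₁ = solve-∀
      lem₂ : ∀ y → - (1ℤ - y - 1ℤ) ≡ y
      lem₂ = solve-∀

  act-neg : ∀ w z → act (map neg w) z ≡ reflect (act w) z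
  act-neg []      z = sym (1-1- z)
  act-neg (i ∷ w) z = trans (s-neg i (act (map neg w) z))
      (cong (λ y → 1ℤ - s i y) (trans (cong (λ y → 1ℤ - y) (act-neg w z)) (1-1- (act w (1ℤ - z)))))

  reflect-involutive : ∀ f z → reflect (reflect f) z ≡ f z
  reflect-involutive f z = trans (1-1- _) (cong f (1-1- z))

  reduced-neg : ∀ (w : Word k) → Reduced w → Reduced (map neg w)
  reduced-neg w red v e = subst₂ ℕ._≤_ (sym (List.length-map neg w)) (List.length-map neg v)
    (red (map neg v) λ z → trans (act-neg v z)
        (trans (cong (λ y → 1ℤ - y) (trans (e (1ℤ - z)) (act-neg w (1ℤ - z))))
        (reflect-involutive (act w) z)))

  negˢ : Subset (suc k) → Subset (suc k)
  negˢ A = Vec.tabulate (λ i → Vec.lookup A (neg i))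

  ∈-negˢ : ∀ A i → i ∈ negˢ A ⇔ neg i ∈ A
  ∈-negˢ A i = mk⇔
    (λ m → Vec.lookup⇒[]= (neg i) A
        (trans (sym (Vec.lookup∘tabulate (λ i → Vec.lookup A (neg i)) i)) (Vec.[]=⇒lookup m)))
    (λ m → Vec.lookup⇒[]= i _ (trans (Vec.lookup∘tabulate (λ i → Vec.lookup A (neg i)) i)
        (Vec.[]=⇒lookup m)))

  negˢ-involutive : ∀ A → negˢ (negˢ A) ≡ A
  negˢ-involutive A = ⊆-antisym
    (λ {i} m → subst (_∈ A) (neg-involutive i) (⇒ (∈-negˢ A (neg i)) (⇒ (∈-negˢ (negˢ A) i) m)))
    (λ {i} m → ⇐ (∈-negˢ (negˢ A) i) (⇐ (∈-negˢ A (neg i)) (subst (_∈ A) (sym (neg-involutive i)) m)))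

  -- Written as a sum over all residues, the cardinality is seen to be unchanged when the residues
  -- are permuted by `neg`.
  card-sum : ∀ {n} (A : Subset n) → card A ≡ ℕ-Sum.sum (λ i → if Vec.lookup A i then 1 else 0)
  card-sum []          = refl
  card-sum (true ∷ A)  = cong suc (card-sum A)
  card-sum (false ∷ A) = card-sum A

  card-negˢ : ∀ A → card (negˢ A) ≡ card A
  card-negˢ A = begin
    card (negˢ A)                                                ≡⟨ card-sum (negˢ A) ⟩
    ℕ-Sum.sum (λ i → if Vec.lookup (negˢ A) i then 1 else 0)               ≡⟨ ℕ-Sum.sum-cong-≗ {suc k}
        (λ i → cong (if_then 1 else 0) (Vec.lookup∘tabulate (λ i → Vec.lookup A (neg i)) i)) ⟩
    ℕ-Sum.sum {suc k} (λ i → if Vec.lookup A (neg i) then 1 else 0)        ≡⟨ ℕ-Sum.sum-permute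
        (λ i → if Vec.lookup A i then 1 else 0) (permutation neg neg neg-involutive neg-involutive) ⟨
    ℕ-Sum.sum (λ i → if Vec.lookup A i then 1 else 0)                      ≡⟨ card-sum A ⟨
    card A                                                       ∎
    where open ≡-Reasoning

  eachOnce-neg : ∀ {A} {w : Word k} → EachOnce A w → EachOnce (negˢ A) (map neg w)
  eachOnce-neg {A} {w} once = record
    { unique = Unique.map⁺ (λ {i} {j} e → trans (sym (neg-involutive i))
        (trans (cong neg e) (neg-involutive j))) O.unique
    ; letters = λ i → mk⇔
        (λ m → let j , m′ , e = ∈-map⁻ neg m in
          ⇐ (∈-negˢ A i) (⇒ (O.letters _)
              (subst (_∈ˡ w) (trans (sym (neg-involutive j)) (cong neg (sym e))) m′)))
        (λ m → subst (_∈ˡ map neg w) (neg-involutive i)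
            (∈-map⁺ neg (⇐ (O.letters (neg i)) (⇒ (∈-negˢ A i) m)))) }
    where module O = EachOnce once

  module _ {A : Subset (suc k)} where
    private
      -- This is 1 - j, whose predecessor is -j: negation turns j and j - 1 into -j and 1 - j, so
      -- the upper member of the pair becomes the lower one.
      pred : I k → I k
      pred j = neg (j ⊕ -1ℤ)
      pred-1 : ∀ j → pred j ⊕ -1ℤ ≡ neg j
      pred-1 j = trans (cong (_⊕ -1ℤ) (neg-⊕ j -1ℤ)) (trans (⊕-⊕ (neg j) 1ℤ -1ℤ) (⊕-0 (neg j)))
      pred-1∈ : ∀ j → j ∈ negˢ A → pred j ⊕ -1ℤ ∈ A
      pred-1∈ j m = subst (_∈ A) (sym (pred-1 j)) (⇒ (∈-negˢ A j) m)
      neg-pred-1 : ∀ j → neg (pred j ⊕ -1ℤ) ≡ j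
      neg-pred-1 j = trans (cong neg (pred-1 j)) (neg-involutive j)

    decreasing-neg : ∀ {w} → Decreasing A w → Increasing (negˢ A) (map neg w)
    decreasing-neg {w} (once , sub) = eachOnce-neg once , λ j m m′ →
      subst₂ (λ x y → x ∷ y ∷ [] ⊆ map neg w) (neg-involutive (j ⊕ -1ℤ)) (neg-pred-1 j)
        (Sublist.map⁺ neg (sub (pred j) (⇒ (∈-negˢ A (j ⊕ -1ℤ)) m′) (pred-1∈ j m)))

    increasing-neg : ∀ {w} → Increasing A w → Decreasing (negˢ A) (map neg w)
    increasing-neg {w} (once , sub) = eachOnce-neg once , λ j m m′ →
      subst₂ (λ x y → x ∷ y ∷ [] ⊆ map neg w) (neg-pred-1 j) (neg-involutive (j ⊕ -1ℤ))
        (Sublist.map⁺ neg (sub (pred j) (⇒ (∈-negˢ A (j ⊕ -1ℤ)) m′) (pred-1∈ j m)))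

  proper-neg : ∀ {A : Subset (suc k)} → Nonempty A × A ⊂ full → Nonempty (negˢ A) × negˢ A ⊂ full
  proper-neg {A} ((i , m) , _ , j , _ , ¬m) =
    (neg i , ⇐ (∈-negˢ A (neg i)) (subst (_∈ A) (sym (neg-involutive i)) m)) ,
    (λ _ → ∈⊤) , neg j , ∈⊤ , λ m′ → ¬m (subst (_∈ A) (neg-involutive j) (⇒ (∈-negˢ A (neg j)) m′))

  assemble-map-neg : (ws : List (Word k)) → assemble (map (map neg) ws) ≡ map neg (assemble ws)
  assemble-map-neg ws = trans (cong concat (sym (List.reverse-map (map neg) ws)))
      (List.concat-map (reverse ws))

  factors-neg : ∀ {Sp Sp′ : Subset (suc k) → Word k → Set} {f As} →
    (∀ {A w} → Sp A w → Sp′ (negˢ A) (map neg w)) → Factors Sp assemble f As → Factors Sp′ assemble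
        (reflect f) (map negˢ As)
  factors-neg {Sp′ = Sp′} {f} sp d = record
    { proper = All.map⁺ (All.map proper-neg D.proper) ; words = map
        (map neg) D.words ; spelled = go D.spelled
    ; reduced = subst Reduced (sym (assemble-map-neg D.words)) (reduced-neg (assemble D.words) D.reduced)
    ; acts = λ z → trans (cong (λ w → act w z) (assemble-map-neg D.words))
        (trans (act-neg (assemble D.words) z) (cong (λ y → 1ℤ - y) (D.acts (1ℤ - z)))) }
    where
    module D = Factors d
    go : ∀ {As ws} → Pointwise _ As ws → Pointwise Sp′ (map negˢ As) (map (map neg) ws)
    go []       = []
    go (p ∷ ps) = sp p ∷ go ps

  factors-cong : ∀ {Sp asm f g As} → (∀ z → f z ≡ g z) → Factors Sp asm f As → Factors Sp asm g As
  factors-cong e d = record { Factors d ; acts = λ z → trans (Factors.acts d z) (e z) }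

  map-negˢ-involutive : ∀ As → map negˢ (map negˢ As) ≡ As
  map-negˢ-involutive []       = refl
  map-negˢ-involutive (A ∷ As) = cong₂ _∷_ (negˢ-involutive A) (map-negˢ-involutive As)

  map-card-negˢ : ∀ As → map card (map negˢ As) ≡ map card As
  map-card-negˢ []       = refl
  map-card-negˢ (A ∷ As) = cong₂ _∷_ (card-negˢ A) (map-card-negˢ As)

  shiftedCount-neg : ∀ ε As i → shiftedCount ε (map negˢ As) (neg i) ≡ shiftedCount (- ε) As i
  shiftedCount-neg ε []       i = refl
  shiftedCount-neg ε (A ∷ As) i = begin
    shiftedCount ε (negˢ A ∷ map negˢ As) (neg i)
      ≡⟨ shiftedCount-∷ ε (negˢ A) (map negˢ As) (neg i) ⟩
    (if does (neg i ∈? negˢ A) then suc else id) (shiftedCount ε (map negˢ As) (neg i ⊕ ε))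
      ≡⟨ cong₂ (λ b n → (if b then suc else id) n) does≡
           (trans (cong (shiftedCount ε (map negˢ As))
               (sym (trans (neg-⊕ i (- ε)) (cong (neg i ⊕_) (ℤ.neg-involutive ε)))))
             (shiftedCount-neg ε As (i ⊕ - ε))) ⟩
    (if does (i ∈? A) then suc else id) (shiftedCount (- ε) As (i ⊕ - ε))
      ≡⟨ shiftedCount-∷ (- ε) A As i ⟨
    shiftedCount (- ε) (A ∷ As) i ∎
    where
    open ≡-Reasoning
    does≡ : does (neg i ∈? negˢ A) ≡ does (i ∈? A)
    does≡ = does-⇔ (mk⇔ (subst (_∈ A) (neg-involutive i) ∘ ⇒ (∈-negˢ A (neg i)))
        (⇐ (∈-negˢ A (neg i)) ∘ subst (_∈ A) (sym (neg-involutive i))))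
      (neg i ∈? negˢ A) (i ∈? A)

  -- Proofs of `_<_` are unique, so a bijection of the witnesses that respects both conditions is
  -- already a bijection of the sets.
  <×<-↔ : ∀ {p p′ q q′ r r′ t t′ : ℤ → ℤ} (f g : ℤ → ℤ) → (∀ z → f (g z) ≡ z) → (∀ z → g (f z) ≡ z) →
    (∀ z → p z < q z → p′ z < q′ z → r (f z) < t (f z) × r′ (f z) < t′ (f z)) →
    (∀ z → r z < t z → r′ z < t′ z → p (g z) < q (g z) × p′ (g z) < q′ (g z)) →
    (∃ λ z → p z < q z × p′ z < q′ z) ↔ (∃ λ z → r z < t z × r′ z < t′ z)
  <×<-↔ {p} {p′} {q} {q′} {r} {r′} {t} {t′} f g fg gf h h′ = mk↔ₛ′ (λ (z , l , m) → f z , h z l m)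
      (λ (z , l , m) → g z , h′ z l m)
    (λ (z , l) → equal {r} {r′} {t} {t′} (fg z)) (λ (z , l) → equal {p} {p′} {q} {q′} (gf z))
    where
    equal : ∀ {p p′ q q′ : ℤ → ℤ} {x y : ∃ λ z → p z < q z × p′ z < q′ z} → proj₁ x ≡ proj₁ y → x ≡ y
    equal {x = z , l , m} {.z , l′ , m′} refl = cong₂ (λ a b → z , a , b) (ℤ.<-irrelevant l l′)
        (ℤ.<-irrelevant m m′)

  1--cancel-< : ∀ {y z} → 1ℤ - y < 1ℤ - z → z < y
  1--cancel-< {y} {z} l = subst₂ _<_ (lem z) (lem y) (ℤ.+-monoʳ-< 1ℤ (ℤ.neg-mono-< l))
    where lem : ∀ z → 1ℤ + - (1ℤ - z) ≡ z
          lem = solve-∀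

  1--mono-< : ∀ {y z} → y < z → 1ℤ - z < 1ℤ - y
  1--mono-< l = ℤ.+-monoʳ-< 1ℤ (ℤ.neg-mono-< l)

  -- The four decompositions of an affine permutation

  module _ (x : AffinePermutation k) where

    private
      module P = AffinePermutation x
      module B = Inverse P.perm

      to∘from : ∀ z → to x (from x z) ≡ z
      to∘from = B.strictlyInverseˡ

      from∘to : ∀ z → from x (to x z) ≡ z
      from∘to = B.strictlyInverseʳ

      normal : Normal (to x)
      normal = record
        { isAffine = affine (periodic {to x} P.periodic)
            (λ {y} {z} e → trans (sym (from∘to y)) (trans (cong (from x) e) (from∘to z)))
        ; isNormal = trans P.normalised (sym total-id) }

    rightIncreasing : The (RightIncreasing x)
        (λ Bs → ∀ i → Fin (RI Bs i) ↔ ∃ λ j → (ι i < j) × (to x j < to x (ι i)))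
    rightIncreasing = transfer {Factors Increasing assemble (to x)} id (λ _ → refl)
        (λ _ → refl) decomposition⇒factors factors⇒decomposition
      (λ {As} q i → subst (λ j → Fin (RI As j) ↔ Inversions (to x) (ι i)) (residue-ι i) (q (ι i)))
      (increasing-factors normal)

    private
      -- A word for x shows that its inverse and reflections are normalised: they are given by the
      -- reversed and the negated word, and the action of a word preserves the total.
      word : ∃ λ w → ∀ z → act w z ≡ to x z
      word = let (_ , (d , _) , _) , _ = increasing-factors normal in assemble (Factors.words d) ,
          Factors.acts d

      w : Word k
      w = proj₁ word

      from≡ : ∀ z → act (reverse w) z ≡ from x z
      from≡ z = trans (cong (act (reverse w)) (trans (sym (to∘from z)) (sym (proj₂ word (from x z)))))
          (act-reverseˡ w (from x z))

      reflect≡ : ∀ {f} v → (∀ z → act v z ≡ f z) → ∀ z → act (map neg v) z ≡ reflect f z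
      reflect≡ v e z = trans (act-neg v z) (cong (λ y → 1ℤ - y) (e (1ℤ - z)))

    -- The inverse of a product of decreasing factors is the product of increasing ones in opposite
    -- order. An inversion of `from x` from i to z is read through j = x⁻¹(z).
    leftDecreasing : The (LeftDecreasing x)
        (λ Cs → ∀ i → Fin (LD Cs i) ↔ ∃ λ j → (j < from x (ι i)) × (ι i < to x j))
    leftDecreasing = transfer {Factors Increasing assemble (from x)} id (λ _ → refl) (λ _ → refl)
      (factors-reverse {Decreasing} {Increasing} {concat} {assemble} decreasing-reverse assemble-map-reverse from∘to to∘from ∘ decomposition⇒factors)
      (factors⇒decomposition ∘ factors-reverse {Increasing} {Decreasing} {assemble} {concat} increasing-reverse concat-map-reverse to∘from from∘to)
      (λ {As} q i → bij i ↔-∘ subst (λ j → Fin (RI As j) ↔ Inversions (from x) (ι i)) (residue-ι i)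
          (q (ι i)))
      (increasing-factors (normal-act (reverse w) from≡))
      where
      bij : ∀ i → Inversions (from x) (ι i) ↔ ∃ λ j → (j < from x (ι i)) × (ι i < to x j)
      bij i = <×<-↔ {const (ι i)} {from x} {id} {const (from x (ι i))} {id} {const (ι i)} {const
          (from x (ι i))} {to x} (from x) (to x) from∘to to∘from
        (λ z l m → m , subst (ι i <_) (sym (to∘from z)) l)
        (λ z l m → m , subst (_< from x (ι i)) (sym (from∘to z)) l)

    -- Inversions of the reflected map at -i become pairs at 1 - (-i) = i + 1, which is where the
    -- shift by one in the formula comes from; later positions become earlier ones.
    rightDecreasing : The (RightDecreasing x)
        (λ As → ∀ i → Fin (RD As i) ↔ ∃ λ j → (j < ι i + 1ℤ) × (to x (ι i + 1ℤ) < to x j))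
    rightDecreasing = transfer {Factors Increasing assemble (reflect (to x))}
        (map negˢ) map-negˢ-involutive map-card-negˢ
      (factors-neg {Decreasing} {Increasing} decreasing-neg ∘ decomposition⇒factors)
      (factors⇒decomposition ∘ factors-cong
          (reflect-involutive (to x)) ∘ factors-neg {Increasing} {Decreasing} {reflect
          (to x)} increasing-neg)
      (λ {As} q i → bij i ↔-∘ subst (λ n → Fin n ↔ Inversions (reflect (to x)) (- ι i)) (count As i)
          (q (- ι i)))
      (increasing-factors (normal-act (map neg w) (reflect≡ w (proj₂ word))))
      where
      count : ∀ As i → RI As (neg i) ≡ RD (map negˢ As) i
      count As i = sym (trans (cong (RD (map negˢ As)) (sym (neg-involutive i)))
          (shiftedCount-neg -1ℤ As (neg i)))
      bij : ∀ i → Inversions (reflect (to x)) (- ι i) ↔ ∃ λ j → (j < ι i + 1ℤ) × (to x (ι i + 1ℤ) < to x j)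
      bij i = <×<-↔ {const (- ι i)} {reflect (to x)} {id} {const (reflect (to x) (- ι i))} {id} {const
          (to x (ι i + 1ℤ))} {const (ι i + 1ℤ)} {to x}
        (λ z → 1ℤ - z) (λ z → 1ℤ - z) 1-1- 1-1-
        (λ z l m → subst (1ℤ - z <_) (lem (ι i)) (1--mono-< l) , subst (λ y → to x y < to x (1ℤ - z))
            (lem (ι i)) (1--cancel-< m))
        (λ z l m → subst (_< 1ℤ - z) (lem′ (ι i)) (1--mono-< l) ,
          1--mono-< (subst₂ (λ y z → to x y < to x z) (sym (lem (ι i))) (sym (1-1- z)) m))
        where
        lem : ∀ i → 1ℤ - - i ≡ i + 1ℤ
        lem = solve-∀
        lem′ : ∀ i → 1ℤ - (i + 1ℤ) ≡ - i
        lem′ = solve-∀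

    -- Inversion moves the first factor to the right end but makes the factors decreasing;
    -- reflection makes them increasing again. So both symmetries are applied, and z is read through
    -- j = x⁻¹(1 - z).
    leftIncreasing : The (LeftIncreasing x)
        (λ Es → ∀ i → Fin (LI Es i) ↔ ∃ λ j → (from x (ι i + 1ℤ) < j) × (to x j < ι i + 1ℤ))
    leftIncreasing = transfer {Factors Increasing assemble (reflect (from x))}
        (map negˢ) map-negˢ-involutive map-card-negˢ
      (factors-neg {Decreasing} {Increasing} decreasing-neg
        ∘ factors-reverse {Increasing} {Decreasing} {concat} {assemble} increasing-reverse assemble-map-reverse from∘to to∘from
        ∘ decomposition⇒factors)
      (factors⇒decomposition
        ∘ factors-reverse {Decreasing} {Increasing} {assemble} {concat} decreasing-reverse concat-map-reverse to∘from from∘to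
        ∘ factors-cong (reflect-involutive (from x)) ∘ factors-neg {Increasing} {Decreasing} {reflect
            (from x)} increasing-neg)
      (λ {As} q i → bij i ↔-∘ subst (λ n → Fin n ↔ Inversions (reflect (from x)) (- ι i)) (count As i)
          (q (- ι i)))
      (increasing-factors (normal-act (map neg (reverse w)) (reflect≡ (reverse w) from≡)))
      where
      count : ∀ As i → RI As (neg i) ≡ LI (map negˢ As) i
      count As i = sym (trans (cong (LI (map negˢ As)) (sym (neg-involutive i)))
          (shiftedCount-neg -1ℤ As (neg i)))
      bij : ∀ i → Inversions (reflect (from x)) (- ι i) ↔ ∃ λ j → (from x (ι i + 1ℤ) < j) ×
          (to x j < ι i + 1ℤ)
      bij i = <×<-↔ {const (- ι i)} {reflect (from x)} {id} {const (reflect (from x) (- ι i))} {const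
          (from x (ι i + 1ℤ))} {to x} {id} {const (ι i + 1ℤ)}
        (λ z → from x (1ℤ - z)) (λ z → 1ℤ - to x z)
        (λ z → trans (cong (from x) (1-1- (to x z))) (from∘to z))
        (λ z → trans (cong (λ y → 1ℤ - y) (to∘from (1ℤ - z))) (1-1- z))
        (λ z l m → subst (λ y → from x y < from x (1ℤ - z)) (lem (ι i)) (1--cancel-< m) ,
          subst₂ _<_ (sym (to∘from (1ℤ - z))) (lem (ι i)) (1--mono-< l))
        (λ z l m → subst (_< 1ℤ - to x z) (lem′ (ι i)) (1--mono-< m) ,
          1--mono-< (subst₂ (λ y z → from x y < z) (sym (lem (ι i)))
              (sym (trans (cong (from x) (1-1- (to x z))) (from∘to z))) l))
        where
        lem : ∀ i → 1ℤ - - i ≡ i + 1ℤ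
        lem = solve-∀
        lem′ : ∀ i → 1ℤ - (i + 1ℤ) ≡ - i
        lem′ = solve-∀

open import Data.Nat.Base using (_≤_)

proposition49 : (k : ℕ) → 1 ≤ k → (x : AffinePermutation k) →
    The (RightDecreasing x) (λ As → (i : I k) →
    Fin (RD As i) ↔ ∃ λ (j : ℤ) → (j < ι i + 1ℤ) × (to x j > to x (ι i + 1ℤ)))
    ×
    The (RightIncreasing x) (λ Bs → (i : I k) →
    Fin (RI Bs i) ↔ ∃ λ (j : ℤ) → (j > ι i) × (to x j < to x (ι i)))
    ×
    The (LeftDecreasing x) (λ Cs → (i : I k) →
    Fin (LD Cs i) ↔ ∃ λ (j : ℤ) → (j < from x (ι i)) × (to x j > ι i))
    ×
    The (LeftIncreasing x) (λ Es → (i : I k) →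
    Fin (LI Es i) ↔ ∃ λ (j : ℤ) → (j > from x (ι i + 1ℤ)) × (to x j < ι i + 1ℤ))
proposition49 k 1≤k x = rightDecreasing x , rightIncreasing x , leftDecreasing x , leftIncreasing x
  where open KCodes k 1≤k
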